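{- Let $V$ be a discrete valuation domain with maximal ideal $\mathfrak{m}=\pi V$ and finite residue field of cardinality $q$, and let $u_n$, $F_n$, $\wp$, $\epsilon_j(u_n)$, $\mathcal{G}_n(x)$ and $e_j(n)$ be as defined in the context. Let $n$ be a nonnegative integer. Then, in $\mathbb{Z}[x]$, $$\mathcal{G}_n(x) \equiv \prod_{j=0}^{q-1} \mathcal{G}_j(x)^{e_j(n)} \pmod{(x^{q-1}-1)}.$$
   Context: $V$ is a discrete valuation domain with maximal ideal $\mathfrak{m}$, quotient field $K$, and finite residue field $V/\mathfrak{m}$ of cardinality $q$; $\pi$ is a generator of $\mathfrak{m}$. Fix elements $u_0,\ldots,u_{q-1}\in V$ with $u_0=0$ such that $R=\{u_0,\ldots,u_{q-1}\}$ is a complete set of representatives of $V$ modulo $\mathfrak{m}$ (one for each residue class). For an integer $n\ge 0$ with $q$-adic expansion $n=n_0+n_1q+\cdots+n_kq^k$, $0\le n_i\le q-1$, put $u_n=u_{n_0}+u_{n_1}\pi+\cdots+u_{n_k}\pi^k\in V$. Define $F_0(x)=1$ and, for $n\ge 1$, $$F_n(x)=\prod_{k=0}^{n-1}\frac{x-u_k}{u_n-u_k}\in K[x].$$ It is known that $F_n(V)\subseteq V$ for all $n\ge 0$. Fix $\wp\in V$ whose residue class generates the cyclic group $(V/\mathfrak{m})^{\times}$. For $n\in\mathbb{Z}_{\ge 0}$ and $j\in\mathbb{Z}$ define $$\epsilon_j(u_n)=\mathrm{card}\{m\in\mathbb{Z} \mid 0\le m\le n \text{ and } F_m(u_n)\equiv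 \wp^j \pmod{\mathfrak{m}}\}.$$ For each integer $n\ge 0$ the generating polynomial is $$\mathcal{G}_n(x)=\sum_{j=0}^{q-2}\epsilon_j(u_n)x^j\in\mathbb{Z}[x].$$ The integers $e_j(n)$, $0\le j\le q-1$, are defined as follows. For $n=0$: $e_0(0)=1$ and $e_j(0)=0$ for $1\le j\le q-1$. For $n>0$, write $n=\sum_{i=0}^r n_iq^i$ with $r\ge 0$, $n_i\in\{0,\ldots,q-1\}$ and $n_r>0$; then $e_j(n)$ is the number of indices $i\in\{0,\ldots,r\}$ with $n_i=j$. -}

module Defs where

open import Algebra.Bundles using (RawRing; CommutativeRing)
import Algebra.Definitions as AlgebraDefinitions
import Algebra.Definitions.RawSemiring as RawSemiringDefinitions
import Algebra.Properties.AbelianGroup as AbelianGroupProperties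
import Algebra.Properties.Semiring.Exp as Exponentiation
import Algebra.Properties.Ring as RingProperties
open import Data.Digit using (Expansion; fromDigits; toDigits)
open import Data.Empty using (⊥-elim)
open import Data.Fin.Base using (Fin; toℕ; fromℕ<) renaming (zero to fzero; suc to fsuc)
import Data.Fin.Properties as Fin
open import Data.Integer.Base as ℤ using (ℤ; +_; -[1+_]; 0ℤ; 1ℤ)
import Data.Integer.Properties as ℤ
open import Data.List.Base using (List; []; _∷_; map; length; filter; allFin; upTo)
open import Data.Nat.Base as ℕ using (ℕ; zero; suc; _∸_)
import Data.Nat.Properties as ℕ
open import Data.Product.Base using (∃; _,_; proj₁; proj₂; _×_)
open import Data.Sum.Base using (inj₁; inj₂)
open import Level using (Level; _⊔_) renaming (suc to lsuc)
open import Relation.Binary.PropositionalEquality as ≡ using (_≡_)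
import Relation.Binary.Reasoning.Setoid as SetoidReasoning
open import Relation.Nullary using (¬_; Dec; yes; no)
open import Relation.Nullary.Decidable using (decidable-stable; fromWitness)

-- A polynomial is the list of its coefficients, constant term first.
-- Lists differing by trailing zeros represent the same polynomial, so
-- equality is coefficientwise.

module Polynomial {c ℓ} (A : CommutativeRing c ℓ) where

  open CommutativeRing A

  Poly : Set c
  Poly = List Carrier

  coeff : Poly → ℕ → Carrier
  coeff []      _       = 0#
  coeff (a ∷ p) zero    = a
  coeff (a ∷ p) (suc i) = coeff p i

  infix  4 _≋_
  infixl 6 _⊞_
  infixl 7 _⊠_

  _≋_ : Poly → Poly → Set ℓ
  p ≋ q = ∀ i → coeff p i ≈ coeff q i

  _⊞_ : Poly → Poly → Poly
  []      ⊞ q       = q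
  (a ∷ p) ⊞ []      = a ∷ p
  (a ∷ p) ⊞ (b ∷ q) = (a + b) ∷ (p ⊞ q)

  _⊠_ : Poly → Poly → Poly
  []      ⊠ q = []
  (a ∷ p) ⊠ q = map (a *_) q ⊞ (0# ∷ (p ⊠ q))

  const : Carrier → Poly
  const a = a ∷ []

  X : Poly
  X = 0# ∷ 1# ∷ []

  polyRawRing : RawRing c ℓ
  polyRawRing = record
    { Carrier = Poly
    ; _≈_     = _≋_
    ; _+_     = _⊞_
    ; _*_     = _⊠_
    ; -_      = map (λ a → - a)
    ; 0#      = []
    ; 1#      = const 1#
    }

  open RawRing polyRawRing public using () renaming (-_ to ⊟_; 1# to 𝟙)
  open RawSemiringDefinitions (RawRing.rawSemiring polyRawRing) public
    using (_^_; product; _∣_)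

  infixl 6 _⊖_
  _⊖_ : Poly → Poly → Poly
  p ⊖ q = p ⊞ ⊟ q

  infix 4 _≡_[mod_]
  _≡_[mod_] : Poly → Poly → Poly → Set (c ⊔ ℓ)
  p ≡ q [mod m ] = m ∣ (p ⊖ q)

  eval : Poly → Carrier → Carrier
  eval []      x = 0#
  eval (a ∷ p) x = a + x * eval p x

  private
    module + = AbelianGroupProperties +-abelianGroup

  open SetoidReasoning setoid

  private
    +-interchange : ∀ a b d e → (a + b) + (d + e) ≈ (a + d) + (b + e)
    +-interchange a b d e = begin
      (a + b) + (d + e)  ≈⟨ +-assoc a b (d + e) ⟩
      a + (b + (d + e))  ≈⟨ +-congˡ (+-assoc b d e) ⟨
      a + ((b + d) + e)  ≈⟨ +-congˡ (+-congʳ (+-comm b d)) ⟩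
      a + ((d + b) + e)  ≈⟨ +-congˡ (+-assoc d b e) ⟩
      a + (d + (b + e))  ≈⟨ +-assoc a d (b + e) ⟨
      (a + d) + (b + e)  ∎

    swap : ∀ x a b → x * (a * b) ≈ a * (x * b)
    swap x a b = trans (sym (*-assoc x a b))
                   (trans (*-congʳ (*-comm x a)) (*-assoc a x b))

  eval-⊞ : ∀ p q x → eval (p ⊞ q) x ≈ eval p x + eval q x
  eval-⊞ []      q       x = sym (+-identityˡ _)
  eval-⊞ (a ∷ p) []      x = sym (+-identityʳ _)
  eval-⊞ (a ∷ p) (b ∷ q) x = begin
    (a + b) + x * eval (p ⊞ q) x             ≈⟨ +-congˡ (*-congˡ (eval-⊞ p q x)) ⟩
    (a + b) + x * (eval p x + eval q x)      ≈⟨ +-congˡ (distribˡ x _ _) ⟩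
    (a + b) + (x * eval p x + x * eval q x)  ≈⟨ +-interchange a b _ _ ⟩
    (a + x * eval p x) + (b + x * eval q x)  ∎

  eval-map-* : ∀ a q x → eval (map (a *_) q) x ≈ a * eval q x
  eval-map-* a []      x = sym (zeroʳ a)
  eval-map-* a (b ∷ q) x = begin
    a * b + x * eval (map (a *_) q) x  ≈⟨ +-congˡ (*-congˡ (eval-map-* a q x)) ⟩
    a * b + x * (a * eval q x)         ≈⟨ +-congˡ (swap x a _) ⟩
    a * b + a * (x * eval q x)         ≈⟨ distribˡ a _ _ ⟨
    a * (b + x * eval q x)             ∎

  eval-⊠ : ∀ p q x → eval (p ⊠ q) x ≈ eval p x * eval q x
  eval-⊠ []      q x = sym (zeroˡ _)
  eval-⊠ (a ∷ p) q x = begin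
    eval (map (a *_) q ⊞ (0# ∷ (p ⊠ q))) x           ≈⟨ eval-⊞ (map (a *_) q) _ x ⟩
    eval (map (a *_) q) x + (0# + x * eval (p ⊠ q) x) ≈⟨ +-cong (eval-map-* a q x) (+-identityˡ _) ⟩
    a * eval q x + x * eval (p ⊠ q) x                ≈⟨ +-congˡ (*-congˡ (eval-⊠ p q x)) ⟩
    a * eval q x + x * (eval p x * eval q x)         ≈⟨ +-congˡ (*-assoc x _ _) ⟨
    a * eval q x + (x * eval p x) * eval q x         ≈⟨ distribʳ _ _ _ ⟨
    (a + x * eval p x) * eval q x                    ∎

  eval-const : ∀ a x → eval (const a) x ≈ a
  eval-const a x = trans (+-congˡ (zeroʳ x)) (+-identityʳ a)

  eval-X : ∀ x → eval X x ≈ x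
  eval-X x = trans (+-identityˡ _) (trans (*-congˡ (eval-const 1# x)) (*-identityʳ x))

  eval-X⊖const : ∀ a x → eval (X ⊖ const a) x ≈ x - a
  eval-X⊖const a x = trans (eval-⊞ X (⊟ const a) x) (+-cong (eval-X x) (eval-const (- a) x))

module ℤ[x] = Polynomial ℤ.+-*-commutativeRing

record Field c ℓ : Set (lsuc (c ⊔ ℓ)) where
  field
    commutativeRing : CommutativeRing c ℓ

  open CommutativeRing commutativeRing public
  open AlgebraDefinitions _≈_ using (Invertible)
  open Exponentiation semiring public using (_^_)

  field
    1≉0        : ¬ 1# ≈ 0#
    invertible : ∀ x → ¬ x ≈ 0# → Invertible 1# _*_ x

  inv : ∀ x → ¬ x ≈ 0# → Carrier
  inv x x≉0 = proj₁ (invertible x x≉0)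

  pow : ∀ x → ¬ x ≈ 0# → ℤ → Carrier
  pow x x≉0 (+ n)    = x ^ n
  pow x x≉0 -[1+ n ] = inv x x≉0 ^ suc n

-- The domain V is the valuation ring of a surjective discrete valuation
-- on K; its quotient field is then K itself.

record DiscreteValuationDomain c ℓ : Set (lsuc (c ⊔ ℓ)) where
  field
    K : Field c ℓ

  open Field K public

  field
    ν            : ∀ x → ¬ x ≈ 0# → ℤ
    ν-cong       : ∀ {x y} (x≉0 : ¬ x ≈ 0#) (y≉0 : ¬ y ≈ 0#) →
                   x ≈ y → ν x x≉0 ≡ ν y y≉0
    ν-*          : ∀ {x y} (x≉0 : ¬ x ≈ 0#) (y≉0 : ¬ y ≈ 0#) (xy≉0 : ¬ x * y ≈ 0#) →
                   ν (x * y) xy≉0 ≡ ν x x≉0 ℤ.+ ν y y≉0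
    ν-+          : ∀ {x y} (x≉0 : ¬ x ≈ 0#) (y≉0 : ¬ y ≈ 0#) (x+y≉0 : ¬ x + y ≈ 0#) →
                   ν x x≉0 ℤ.⊓ ν y y≉0 ℤ.≤ ν (x + y) x+y≉0
    ν-surjective : ∀ k → ∃ λ x → ∃ λ (x≉0 : ¬ x ≈ 0#) → ν x x≉0 ≡ k

  infix 4 _∈V _∈𝔪 _≡_[𝔪]

  -- Writing "x = 0 or ν x ≥ 0" as an implication spares assuming that
  -- equality with 0 is decidable; likewise for 𝔪.

  _∈V : Carrier → Set ℓ
  x ∈V = (x≉0 : ¬ x ≈ 0#) → 0ℤ ℤ.≤ ν x x≉0

  _∈𝔪 : Carrier → Set ℓ
  x ∈𝔪 = (x≉0 : ¬ x ≈ 0#) → 0ℤ ℤ.< ν x x≉0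

  _≡_[𝔪] : Carrier → Carrier → Set ℓ
  x ≡ y [𝔪] = (x - y) ∈𝔪

module _ {c ℓ} (V : DiscreteValuationDomain c ℓ) where

  open DiscreteValuationDomain V

  -- The existence of a system indexed by Fin q also says that the residue
  -- field V/𝔪 has exactly q elements.

  record Representatives (q : ℕ) : Set (c ⊔ ℓ) where
    field
      rep      : Fin q → Carrier
      rep∈V    : ∀ i → rep i ∈V
      rep₀     : ∀ i → toℕ i ≡ 0 → rep i ≈ 0#
      complete : ∀ x → x ∈V → ∃ λ i → x ≡ rep i [𝔪]
      distinct : ∀ i j → rep i ≡ rep j [𝔪] → i ≡ j

  record Uniformizer : Set (c ⊔ ℓ) where
    field
      π         : Carrier
      π∈𝔪       : π ∈𝔪
      generates : ∀ x → x ∈𝔪 → ∃ λ y → y ∈V × x ≈ π * y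

  -- Powers of ℘ are formed in K; since ℘ is a unit of V they lie in V, and
  -- their classes are the powers of the class of ℘ in (V/𝔪)ˣ.

  record PrimitiveElement : Set (c ⊔ ℓ) where
    field
      ℘   : Carrier
      ℘∈V : ℘ ∈V
      ℘∉𝔪 : ¬ ℘ ∈𝔪

    ℘≉0 : ¬ ℘ ≈ 0#
    ℘≉0 ℘≈0 = ℘∉𝔪 (λ ℘≉0 → ⊥-elim (℘≉0 ℘≈0))

    field
      generates : ∀ x → x ∈V → ¬ x ∈𝔪 → ∃ λ k → x ≡ pow ℘ ℘≉0 k [𝔪]

-- This module and the next supply what F and ε need in order to be
-- defined: the denominators u n - u k are nonzero and the congruences
-- counted by ε are decidable.

module ValuationProperties {c ℓ} (V : DiscreteValuationDomain c ℓ) where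

  open DiscreteValuationDomain V
  open SetoidReasoning setoid
  module +P = AbelianGroupProperties +-abelianGroup
  module *P = RingProperties ring

  x≈0⇒xy≈0 : ∀ {x y} → x ≈ 0# → x * y ≈ 0#
  x≈0⇒xy≈0 x≈0 = trans (*-congʳ x≈0) (zeroˡ _)

  y≈0⇒xy≈0 : ∀ {x y} → y ≈ 0# → x * y ≈ 0#
  y≈0⇒xy≈0 y≈0 = trans (*-congˡ y≈0) (zeroʳ _)

  inverseʳ* : ∀ x (x≉0 : ¬ x ≈ 0#) → x * inv x x≉0 ≈ 1#
  inverseʳ* x x≉0 = proj₂ (proj₂ (invertible x x≉0))

  inverseˡ* : ∀ x (x≉0 : ¬ x ≈ 0#) → inv x x≉0 * x ≈ 1#
  inverseˡ* x x≉0 = proj₁ (proj₂ (invertible x x≉0))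

  inv≉0 : ∀ x (x≉0 : ¬ x ≈ 0#) → ¬ inv x x≉0 ≈ 0#
  inv≉0 x x≉0 eq = 1≉0 (trans (sym (inverseʳ* x x≉0)) (y≈0⇒xy≈0 eq))

  *-cancelˡ : ∀ x {y z} → ¬ x ≈ 0# → x * y ≈ x * z → y ≈ z
  *-cancelˡ x {y} {z} x≉0 eq = begin
    y                    ≈⟨ *-identityˡ y ⟨
    1# * y               ≈⟨ *-congʳ (inverseˡ* x x≉0) ⟨
    (inv x x≉0 * x) * y  ≈⟨ *-assoc _ x y ⟩
    inv x x≉0 * (x * y)  ≈⟨ *-congˡ eq ⟩
    inv x x≉0 * (x * z)  ≈⟨ *-assoc _ x z ⟨
    (inv x x≉0 * x) * z  ≈⟨ *-congʳ (inverseˡ* x x≉0) ⟩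
    1# * z               ≈⟨ *-identityˡ z ⟩
    z                    ∎

  *≉0 : ∀ {x y} → ¬ x ≈ 0# → ¬ y ≈ 0# → ¬ x * y ≈ 0#
  *≉0 {x} x≉0 y≉0 xy≈0 = y≉0 (*-cancelˡ x x≉0 (trans xy≈0 (sym (zeroʳ x))))

  -- V and 𝔪 are both of the form {x | x = 0 or P (ν x)}.

  private
    Sub : (ℤ → Set) → Carrier → Set ℓ
    Sub P x = (x≉0 : ¬ x ≈ 0#) → P (ν x x≉0)

    Sub-cong : ∀ P {x y} → x ≈ y → Sub P x → Sub P y
    Sub-cong P x≈y x∈ y≉0 =
      ≡.subst P (ν-cong (λ x≈0 → y≉0 (trans (sym x≈y) x≈0)) y≉0 x≈y) (x∈ _)

    Sub-+ : ∀ P → (∀ i → Dec (P i)) → (∀ {i j} → i ℤ.≤ j → P i → P j) →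
            ∀ {x y} → Sub P x → Sub P y → Sub P (x + y)
    Sub-+ P P? up {x} {y} x∈ y∈ x+y≉0 = decidable-stable (P? _) λ ¬P →
      let x≉0 : ¬ x ≈ 0#
          x≉0 x≈0 = ¬P (Sub-cong P (sym (trans (+-congʳ x≈0) (+-identityˡ y))) y∈ x+y≉0)
          y≉0 : ¬ y ≈ 0#
          y≉0 y≈0 = ¬P (Sub-cong P (sym (trans (+-congˡ y≈0) (+-identityʳ x))) x∈ x+y≉0)
      in ¬P (up (ν-+ x≉0 y≉0 x+y≉0) (⊓-closed (x∈ x≉0) (y∈ y≉0)))
      where
      ⊓-closed : ∀ {i j} → P i → P j → P (i ℤ.⊓ j)
      ⊓-closed {i} {j} p q with ℤ.⊓-sel i j
      ... | inj₁ eq = ≡.subst P (≡.sym eq) p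
      ... | inj₂ eq = ≡.subst P (≡.sym eq) q

    double-zero : ∀ i → i ℤ.+ i ≡ 0ℤ → i ≡ 0ℤ
    double-zero (+ zero)  eq = ≡.refl
    double-zero (+ suc n) ()
    double-zero -[1+ n ]  ()

    unit-zero : ∀ i → i ℤ.+ i ≡ i → i ≡ 0ℤ
    unit-zero i eq = AbelianGroupProperties.∙-cancelˡ ℤ.+-0-abelianGroup i i 0ℤ (≡.trans eq (≡.sym (ℤ.+-identityʳ i)))

  ∈V-cong : ∀ {x y} → x ≈ y → x ∈V → y ∈V
  ∈V-cong = Sub-cong (0ℤ ℤ.≤_)

  ∈𝔪-cong : ∀ {x y} → x ≈ y → x ∈𝔪 → y ∈𝔪
  ∈𝔪-cong = Sub-cong (0ℤ ℤ.<_)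

  𝔪⊆V : ∀ {x} → x ∈𝔪 → x ∈V
  𝔪⊆V x∈ x≉0 = ℤ.<⇒≤ (x∈ x≉0)

  0∈V : 0# ∈V
  0∈V 0≉0 = ⊥-elim (0≉0 refl)

  V-+ : ∀ {x y} → x ∈V → y ∈V → (x + y) ∈V
  V-+ = Sub-+ (0ℤ ℤ.≤_) (0ℤ ℤ.≤?_) (λ i≤j 0≤i → ℤ.≤-trans 0≤i i≤j)

  𝔪-+ : ∀ {x y} → x ∈𝔪 → y ∈𝔪 → (x + y) ∈𝔪
  𝔪-+ = Sub-+ (0ℤ ℤ.<_) (0ℤ ℤ.<?_) (λ i≤j 0<i → ℤ.<-≤-trans 0<i i≤j)

  V-* : ∀ {x y} → x ∈V → y ∈V → (x * y) ∈V
  V-* x∈ y∈ xy≉0 = ≡.subst (0ℤ ℤ.≤_) (≡.sym (ν-* x≉0 y≉0 xy≉0))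
                     (ℤ.+-mono-≤ (x∈ x≉0) (y∈ y≉0))
    where
    x≉0 = λ x≈0 → xy≉0 (x≈0⇒xy≈0 x≈0)
    y≉0 = λ y≈0 → xy≉0 (y≈0⇒xy≈0 y≈0)

  𝔪-* : ∀ {x y} → x ∈𝔪 → y ∈V → (x * y) ∈𝔪
  𝔪-* x∈ y∈ xy≉0 = ≡.subst (0ℤ ℤ.<_) (≡.sym (ν-* x≉0 y≉0 xy≉0))
                     (ℤ.+-mono-<-≤ (x∈ x≉0) (y∈ y≉0))
    where
    x≉0 = λ x≈0 → xy≉0 (x≈0⇒xy≈0 x≈0)
    y≉0 = λ y≈0 → xy≉0 (y≈0⇒xy≈0 y≈0)

  ν-1 : ∀ (1≉0 : ¬ 1# ≈ 0#) → ν 1# 1≉0 ≡ 0ℤ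
  ν-1 1≉0 = unit-zero _ (≡.trans (≡.sym (ν-* 1≉0 1≉0 11≉0)) (ν-cong 11≉0 1≉0 (*-identityˡ 1#)))
    where 11≉0 = *≉0 1≉0 1≉0

  1∈V : 1# ∈V
  1∈V 1≉0 = ℤ.≤-reflexive (≡.sym (ν-1 1≉0))

  1∉𝔪 : ¬ 1# ∈𝔪
  1∉𝔪 1∈ = ℤ.<-irrefl (≡.sym (ν-1 1≉0)) (1∈ 1≉0)

  -1∈V : (- 1#) ∈V
  -1∈V -1≉0 = ℤ.≤-reflexive (≡.sym (double-zero _
    (≡.trans (≡.sym (ν-* -1≉0 -1≉0 sq≉0)) (≡.trans (ν-cong sq≉0 1≉0 sq≈1) (ν-1 1≉0)))))
    where
    sq≉0 = *≉0 -1≉0 -1≉0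
    sq≈1 : - 1# * - 1# ≈ 1#
    sq≈1 = trans (*P.-1*x≈-x (- 1#)) (+P.⁻¹-involutive 1#)

  V-neg : ∀ {x} → x ∈V → (- x) ∈V
  V-neg {x} x∈ = ∈V-cong (*P.-1*x≈-x x) (V-* -1∈V x∈)

  𝔪-neg : ∀ {x} → x ∈𝔪 → (- x) ∈𝔪
  𝔪-neg {x} x∈ = ∈𝔪-cong (trans (*-comm x (- 1#)) (*P.-1*x≈-x x)) (𝔪-* x∈ -1∈V)

  inv∈V : ∀ {x} → x ∈V → ¬ x ∈𝔪 → (x≉0 : ¬ x ≈ 0#) → inv x x≉0 ∈V
  inv∈V {x} x∈ x∉ x≉0 i≉0 = ≡.subst (0ℤ ℤ.≤_) νi≡ ℤ.≤-refl
    where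
    νx≡0 : ν x x≉0 ≡ 0ℤ
    νx≡0 = ℤ.≤-antisym
      (ℤ.≮⇒≥ (λ 0<ν → x∉ (λ p → ≡.subst (0ℤ ℤ.<_) (ν-cong x≉0 p refl) 0<ν)))
      (x∈ x≉0)
    xi≉0 = *≉0 x≉0 i≉0
    νi≡ : 0ℤ ≡ ν (inv x x≉0) i≉0
    νi≡ = ≡.trans (≡.sym (≡.trans (≡.sym (ν-* x≉0 i≉0 xi≉0))
                           (≡.trans (ν-cong xi≉0 1≉0 (inverseʳ* x x≉0)) (ν-1 1≉0))))
                  (≡.trans (≡.cong (ℤ._+ ν (inv x x≉0) i≉0) νx≡0) (ℤ.+-identityˡ _))

  pow∈V : ∀ {x} → x ∈V → ¬ x ∈𝔪 → (x≉0 : ¬ x ≈ 0#) → ∀ k → pow x x≉0 k ∈V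
  pow∈V {x} x∈ x∉ x≉0 = go
    where
    ^∈V : ∀ {y} → y ∈V → ∀ n → (y ^ n) ∈V
    ^∈V y∈ zero    = 1∈V
    ^∈V y∈ (suc n) = V-* y∈ (^∈V y∈ n)
    go : ∀ k → pow x x≉0 k ∈V
    go (+ n)    = ^∈V x∈ n
    go -[1+ n ] = ^∈V (inv∈V x∈ x∉ x≉0) (suc n)

  telescope : ∀ x y z → (x - y) + (y - z) ≈ x - z
  telescope x y z = begin
    (x - y) + (y - z)    ≈⟨ +-assoc x (- y) (y - z) ⟩
    x + (- y + (y - z))  ≈⟨ +-congˡ (+-assoc (- y) y (- z)) ⟨
    x + ((- y + y) - z)  ≈⟨ +-congˡ (+-congʳ (-‿inverseˡ y)) ⟩
    x + (0# - z)         ≈⟨ +-congˡ (+-identityˡ (- z)) ⟩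
    x - z                ∎

  neg-minus : ∀ x y → - (x - y) ≈ y - x
  neg-minus x y = trans (sym (+P.⁻¹-∙-comm x (- y)))
                    (trans (+-congˡ (+P.⁻¹-involutive y)) (+-comm (- x) y))

  minus-+ : ∀ x y → (x - y) + y ≈ x
  minus-+ x y = trans (+-assoc x (- y) y) (trans (+-congˡ (-‿inverseˡ y)) (+-identityʳ x))

  ≡𝔪-refl : ∀ {x} → x ≡ x [𝔪]
  ≡𝔪-refl {x} x-x≉0 = ⊥-elim (x-x≉0 (-‿inverseʳ x))

  ≡𝔪-sym : ∀ {x y} → x ≡ y [𝔪] → y ≡ x [𝔪]
  ≡𝔪-sym {x} {y} p = ∈𝔪-cong (neg-minus x y) (𝔪-neg p)

  ≡𝔪-trans : ∀ {x y z} → x ≡ y [𝔪] → y ≡ z [𝔪] → x ≡ z [𝔪]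
  ≡𝔪-trans {x} {y} {z} p q = ∈𝔪-cong (telescope x y z) (𝔪-+ p q)

module RepresentativesProperties
  {c ℓ} (V : DiscreteValuationDomain c ℓ) {q : ℕ} (R : Representatives V q) where

  open DiscreteValuationDomain V
  open ValuationProperties V
  open Representatives R
  open Polynomial commutativeRing using (eval)
  open SetoidReasoning setoid

  class : ∀ {x} → x ∈V → Fin q
  class x∈ = proj₁ (complete _ x∈)

  q≥2 : 2 ℕ.≤ q
  q≥2 = two-elements (class 0∈V) (class 1∈V) λ eq →
    1∉𝔪 (∈𝔪-cong (trans (+-congˡ +P.ε⁻¹≈ε) (+-identityʳ 1#))
      (≡𝔪-trans (≡.subst (λ i → 1# ≡ rep i [𝔪]) (≡.sym eq) (proj₂ (complete _ 1∈V)))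
                 (≡𝔪-sym (proj₂ (complete _ 0∈V)))))
    where
    two-elements : ∀ {n} (i j : Fin n) → ¬ i ≡ j → 2 ℕ.≤ n
    two-elements {1}           fzero fzero i≢j = ⊥-elim (i≢j ≡.refl)
    two-elements {suc (suc n)} i     j     i≢j = ℕ.s≤s (ℕ.s≤s ℕ.z≤n)

  -- x need not be known to lie in V.
  ≡𝔪-dec : ∀ {x z} → ¬ x ≈ 0# → z ∈V → Dec (x ≡ z [𝔪])
  ≡𝔪-dec {x} {z} x≉0 z∈ with 0ℤ ℤ.≤? ν x x≉0
  ... | no  ν<0 = no λ x≡z → ν<0 (∈V-cong (minus-+ x z) (V-+ (𝔪⊆V x≡z) z∈) x≉0)
  ... | yes 0≤ν = decide (λ p → ≡.subst (0ℤ ℤ.≤_) (ν-cong x≉0 p refl) 0≤ν)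
    where
    decide : x ∈V → Dec (x ≡ z [𝔪])
    decide x∈ with class x∈ Fin.≟ class z∈
    ... | yes eq = yes (≡𝔪-trans (proj₂ (complete _ x∈))
                         (≡𝔪-sym (≡.subst (λ i → z ≡ rep i [𝔪]) (≡.sym eq) (proj₂ (complete _ z∈)))))
    ... | no  ne = no λ x≡z → ne (distinct _ _
                         (≡𝔪-trans (≡𝔪-sym (proj₂ (complete _ x∈)))
                           (≡𝔪-trans x≡z (proj₂ (complete _ z∈)))))

  module _ (P : Uniformizer V) where

    open Uniformizer P

    π≉0 : ¬ π ≈ 0#
    π≉0 π≈0 with t , t≉0 , νt≡1 ← ν-surjective 1ℤ
            with y , _ , t≈πy ← generates t (λ p → ≡.subst (0ℤ ℤ.<_)
                                  (≡.trans (≡.sym νt≡1) (ν-cong t≉0 p refl)) (ℤ.+<+ (ℕ.s≤s ℕ.z≤n)))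
            = t≉0 (trans t≈πy (x≈0⇒xy≈0 π≈0))

    value : Expansion q → Carrier
    value ds = eval (map rep ds) π

    value∈V : ∀ ds → value ds ∈V
    value∈V []       = 0∈V
    value∈V (d ∷ ds) = V-+ (rep∈V d) (V-* (𝔪⊆V π∈𝔪) (value∈V ds))

    value-≡𝔪 : ∀ d ds → value (d ∷ ds) ≡ rep d [𝔪]
    value-≡𝔪 d ds = ∈𝔪-cong eq (𝔪-* π∈𝔪 (value∈V ds))
      where
      eq : π * value ds ≈ (rep d + π * value ds) - rep d
      eq = begin
        π * value ds                      ≈⟨ +-identityʳ _ ⟨
        π * value ds + 0#                 ≈⟨ +-congˡ (-‿inverseʳ (rep d)) ⟨
        π * value ds + (rep d - rep d)    ≈⟨ +-assoc _ _ _ ⟨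
        (π * value ds + rep d) - rep d    ≈⟨ +-congʳ (+-comm _ _) ⟩
        (rep d + π * value ds) - rep d    ∎

    ≈⇒≡𝔪 : ∀ {x y} → x ≈ y → x ≡ y [𝔪]
    ≈⇒≡𝔪 {x} {y} x≈y = ∈𝔪-cong (+-congˡ (-‿cong x≈y)) ≡𝔪-refl

    private
      0F : Fin q
      0F = fromℕ< (ℕ.≤-trans (ℕ.s≤s ℕ.z≤n) q≥2)

      toℕ-0F : toℕ 0F ≡ 0
      toℕ-0F = Fin.toℕ-fromℕ< _

    value-head : ∀ d ds e es → value (d ∷ ds) ≈ value (e ∷ es) → d ≡ e
    value-head d ds e es eq = distinct d e
      (≡𝔪-trans (≡𝔪-sym (value-≡𝔪 d ds)) (≡𝔪-trans (≈⇒≡𝔪 eq) (value-≡𝔪 e es)))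

    value-tail : ∀ d ds e es → value (d ∷ ds) ≈ value (e ∷ es) → value ds ≈ value es
    value-tail d ds e es eq = cancel (value-head d ds e es eq) eq
      where
      cancel : ∀ {d e} → d ≡ e → value (d ∷ ds) ≈ value (e ∷ es) → value ds ≈ value es
      cancel {d} ≡.refl eq = *-cancelˡ π π≉0 (+P.∙-cancelˡ (rep d) _ _ eq)

    value-pad : value [] ≈ value (0F ∷ [])
    value-pad = sym (trans (+-cong (rep₀ 0F toℕ-0F) (zeroʳ π)) (+-identityˡ 0#))

    value-injective : ∀ ds es → value ds ≈ value es → fromDigits ds ≡ fromDigits es
    value-injective []       []       eq = ≡.refl
    value-injective []       (e ∷ es) eq = ≡.cong₂ (λ a b → a ℕ.+ b ℕ.* q)
      (≡.trans (≡.sym toℕ-0F) (≡.cong toℕ (value-head 0F [] e es eq′)))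
      (value-injective [] es (value-tail 0F [] e es eq′))
      where eq′ = trans (sym value-pad) eq
    value-injective (d ∷ ds) []       eq = ≡.cong₂ (λ a b → a ℕ.+ b ℕ.* q)
      (≡.trans (≡.cong toℕ (value-head d ds 0F [] eq′)) toℕ-0F)
      (value-injective ds [] (value-tail d ds 0F [] eq′))
      where eq′ = trans eq value-pad
    value-injective (d ∷ ds) (e ∷ es) eq = ≡.cong₂ (λ a b → toℕ a ℕ.+ b ℕ.* q)
      (value-head d ds e es eq)
      (value-injective ds es (value-tail d ds e es eq))

module Construction
  {c ℓ} (V : DiscreteValuationDomain c ℓ) {q : ℕ} (R : Representatives V q)
  (Π : Uniformizer V) (G : PrimitiveElement V) where

  open DiscreteValuationDomain V
  open Representatives R
  open Uniformizer Π using (π)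
  open PrimitiveElement G using (℘; ℘∈V; ℘∉𝔪; ℘≉0)
  open ValuationProperties V
  open RepresentativesProperties V R
  module K[x] = Polynomial commutativeRing

  -- q-adic digits, least significant first; the last one is nonzero,
  -- except that the digits of 0 are [ 0 ].
  digits : ℕ → List (Fin q)
  digits n = proj₁ (toDigits q {fromWitness q≥2} n)

  -- u n = Σᵢ rep nᵢ * πⁱ
  u : ℕ → Carrier
  u n = K[x].eval (map rep (digits n)) π

  u-distinct : ∀ {k n} → k ℕ.< n → ¬ u n - u k ≈ 0#
  u-distinct {k} {n} k<n eq = ℕ.<-irrefl (≡.trans (≡.sym (proj₂ (toDigits q k)))
    (≡.trans (≡.sym (value-injective Π (digits n) (digits k) un≈uk)) (proj₂ (toDigits q n)))) k<n
    where
    un≈uk : u n ≈ u k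
    un≈uk = trans (sym (minus-+ (u n) (u k))) (trans (+-congʳ eq) (+-identityˡ _))

  F : ℕ → K[x].Poly
  F n = product λ (k : Fin n) →
          const (inv (u n - u (toℕ k)) (u-distinct (Fin.toℕ<n k))) ⊠ (X ⊖ const (u (toℕ k)))
    where open K[x]

  F-nonzero : ∀ {m n} → m ℕ.≤ n → ¬ K[x].eval (F m) (u n) ≈ 0#
  F-nonzero {m} {n} m≤n = product≉0 _ λ k eq →
    *≉0 (inv≉0 _ _) (u-distinct (ℕ.<-≤-trans (Fin.toℕ<n k) m≤n))
        (trans (sym (trans (eval-⊠ (const _) (X ⊖ const _) (u n))
                           (*-cong (eval-const _ (u n)) (eval-X⊖const _ (u n))))) eq)
    where
    open K[x]
    product≉0 : ∀ {k x} (p : Fin k → Poly) → (∀ i → ¬ eval (p i) x ≈ 0#) →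
                ¬ eval (product p) x ≈ 0#
    product≉0 {zero}      p p≉0 eq = 1≉0 (trans (sym (eval-const 1# _)) eq)
    product≉0 {suc k} {x} p p≉0 eq =
      *≉0 (p≉0 fzero) (product≉0 (λ i → p (fsuc i)) (λ i → p≉0 (fsuc i)))
          (trans (sym (eval-⊠ (p fzero) _ x)) eq)

  ε? : ∀ j n (m : Fin (suc n)) → Dec (K[x].eval (F (toℕ m)) (u n) ≡ pow ℘ ℘≉0 j [𝔪])
  ε? j n m = ≡𝔪-dec (F-nonzero (ℕ.≤-pred (Fin.toℕ<n m))) (pow∈V ℘∈V ℘∉𝔪 ℘≉0 j)

  -- ε j n stands for ε_j(u_n).
  ε : ℤ → ℕ → ℕ
  ε j n = length (filter (ε? j n) (allFin (suc n)))

  𝒢 : ℕ → ℤ[x].Poly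
  𝒢 n = map (λ j → + ε (+ j) n) (upTo (q ∸ 1))

  e : Fin q → ℕ → ℕ
  e j n = length (filter (j Fin.≟_) (digits n))

{-# OPTIONS --safe #-}

-- Write n = d + n′ q. In F_m(u_n) with m = a + m′ q, group the factors u_n - u_k
-- by the digits of k: those of k ≡ d (mod q) are π (u_n′ - u_k′), the others of a
-- full block multiply to the product of all nonzero residues, and what remains is
-- F_a(u_d). The same happens in the denominator, whence a Lucas congruence
-- F_m(u_n) ≡ F_a(u_d) F_m′(u_n′) (mod 𝔪). As ℘^i ↦ x^i is a character of the
-- residue field with values in ℤ[x]/(x^(q-1) - 1), and 𝒢_n is the sum over m of its
-- values at F_m(u_n), this gives 𝒢_n ≡ 𝒢_d 𝒢_n′.

module Submission where

open import Defs
open import Data.Fin.Base using (Fin; toℕ)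
open import Data.Nat.Base using (ℕ; _∸_)
open import Algebra.Bundles using (CommutativeMonoid; CommutativeRing)
import Algebra.Definitions.RawMagma as Divisibility
import Algebra.Definitions.RawMonoid as RawMonoidDefinitions
import Algebra.Properties.AbelianGroup as AbelianGroupProperties
import Algebra.Properties.CommutativeMonoid.Sum as Sum
import Algebra.Properties.CommutativeSemigroup as CommutativeSemigroupProperties
import Algebra.Properties.CommutativeSemiring.Exp as Exp
import Algebra.Properties.Ring as RingProperties
import Algebra.Properties.Semiring.Sum as SemiringSum
import Algebra.Solver.Ring.NaturalCoefficients.Default as SemiringSolver
open import Data.Bool.Base using (if_then_else_)
open import Data.Digit using (fromDigits; toDigits)
open import Data.Fin.Base using (zero; suc; fromℕ<; inject≤; punchIn; punchOut)
open import Data.Fin.Permutation using (Permutation′; _⟨$⟩ʳ_; permutation; punchIn-permute; remove)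
import Data.Fin.Properties as Fin
open import Data.Integer.Base as ℤ using (ℤ; +_; -[1+_]; 0ℤ; 1ℤ)
import Data.Integer.Properties as ℤ
open import Data.List.Base using (List; []; _∷_; applyUpTo; filter; length; map; tabulate; upTo)
open import Data.List.Properties using (map-cong; map-upTo)
open import Data.Nat.Base as ℕ using (zero; suc; _≤_; _<_; s≤s; z≤n)
open import Data.Nat.DivMod using (DivMod; _%_; _/_; _divMod_; [m+kn]%n≡m%n; m%n<n; m<n⇒m%n≡m; m≡m%n+[m/n]*n)
import Data.Nat.Properties as ℕ
open import Data.Product.Base using (∃; _×_; _,_; proj₁; proj₂)
open import Data.Sum.Base using (_⊎_; inj₁; inj₂)
open import Function.Base using (_∘_; id)
open import Level using (_⊔_)
open import Relation.Binary.Bundles using (Setoid)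
open import Relation.Binary.Definitions using (tri<; tri≈; tri>)
open import Relation.Binary.PropositionalEquality as ≡ using (_≡_)
import Relation.Binary.Reasoning.Setoid as SetoidReasoning
open import Relation.Binary.Structures using (IsEquivalence)
open import Relation.Nullary using (¬_; Dec; yes; no; contradiction; does)

-- The denominators of `F m` may lie in 𝔪, so `F m` cannot be reduced modulo 𝔪 factor by factor. The
-- regrouping is therefore carried out in K, as an equation between products: the `m′` full blocks
-- give the same power of π above and below, and only after its cancellation is the equation read in
-- the residue field. That the values F_m(u_n) lie in V comes out of the same equation, by induction
-- on the digits of n.
--
-- The index set m ≤ n is not a rectangle in the coordinates (a, m′), so the sum does not split as
-- it stands. Since F_m(u_n) = 0 for m > n, it may be extended to m < (n′ + 1) q, where a and m′ run
-- independently.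
--
-- The map ℘^i ↦ x^i is well defined only if ℘ has an order divisible by q - 1, and each class is
-- counted once only if the order is no smaller. The hypothesis on ℘ says just that its integral
-- powers exhaust the nonzero classes; the order q - 1 is then found by counting, with a pigeonhole
-- from above and distinct logarithms from below.

-- Coefficient lists up to trailing zeros form a commutative ring.

module PolynomialRing {c ℓ} (A : CommutativeRing c ℓ) where

  open CommutativeRing A hiding (zero)
  open Polynomial A
  open SemiringSolver commutativeSemiring using (solve; _:+_; _:=_)

  -- _≋_ unfolds to a family of equations, from which Agda cannot recover the
  -- two polynomials; this wrapper keeps them visible to unification.

  infix 4 _≅_
  record _≅_ (p q : Poly) : Set ℓ where
    constructor wrap
    field unwrap : p ≋ q
  open _≅_ public

  private
    module A = RingProperties ring

  ≅-isEquivalence : IsEquivalence _≅_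
  ≅-isEquivalence = record
    { refl  = wrap λ i → refl
    ; sym   = λ (wrap e) → wrap λ i → sym (e i)
    ; trans = λ (wrap e) (wrap f) → wrap λ i → trans (e i) (f i)
    }

  private
    module ≅ = IsEquivalence ≅-isEquivalence

  ≅-setoid : Setoid c ℓ
  ≅-setoid = record { isEquivalence = ≅-isEquivalence }

  open SetoidReasoning ≅-setoid

  coeff-⊞ : ∀ p q i → coeff (p ⊞ q) i ≈ coeff p i + coeff q i
  coeff-⊞ []      q       i       = sym (+-identityˡ _)
  coeff-⊞ (a ∷ p) []      i       = sym (+-identityʳ _)
  coeff-⊞ (a ∷ p) (b ∷ q) zero    = refl
  coeff-⊞ (a ∷ p) (b ∷ q) (suc i) = coeff-⊞ p q i

  coeff-scale : ∀ a p i → coeff (map (a *_) p) i ≈ a * coeff p i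
  coeff-scale a []      i       = sym (zeroʳ a)
  coeff-scale a (b ∷ p) zero    = refl
  coeff-scale a (b ∷ p) (suc i) = coeff-scale a p i

  coeff-⊟ : ∀ p i → coeff (⊟ p) i ≈ - coeff p i
  coeff-⊟ []      i       = sym A.-0#≈0#
  coeff-⊟ (a ∷ p) zero    = refl
  coeff-⊟ (a ∷ p) (suc i) = coeff-⊟ p i

  ∷-cong : ∀ {a b p q} → a ≈ b → p ≅ q → a ∷ p ≅ b ∷ q
  ∷-cong a≈b (wrap e) = wrap λ { zero → a≈b ; (suc i) → e i }

  ∷-zero : ∀ {a p} → a ≈ 0# → p ≅ [] → a ∷ p ≅ []
  ∷-zero a≈0 (wrap e) = wrap λ { zero → a≈0 ; (suc i) → e i }

  ⊞-cong : ∀ {p q r s} → p ≅ q → r ≅ s → p ⊞ r ≅ q ⊞ s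
  ⊞-cong {p} {q} {r} {s} (wrap e) (wrap f) = wrap λ i →
    trans (coeff-⊞ p r i) (trans (+-cong (e i) (f i)) (sym (coeff-⊞ q s i)))

  ⊟-cong : ∀ {p q} → p ≅ q → ⊟ p ≅ ⊟ q
  ⊟-cong {p} {q} (wrap e) = wrap λ i →
    trans (coeff-⊟ p i) (trans (-‿cong (e i)) (sym (coeff-⊟ q i)))

  scale-cong : ∀ {a b p q} → a ≈ b → p ≅ q → map (a *_) p ≅ map (b *_) q
  scale-cong {a} {b} {p} {q} a≈b (wrap e) = wrap λ i →
    trans (coeff-scale a p i) (trans (*-cong a≈b (e i)) (sym (coeff-scale b q i)))

  ⊞-assoc : ∀ p q r → (p ⊞ q) ⊞ r ≅ p ⊞ (q ⊞ r)
  ⊞-assoc p q r = wrap λ i →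
    trans (coeff-⊞ (p ⊞ q) r i) (trans (+-congʳ (coeff-⊞ p q i)) (trans (+-assoc _ _ _)
      (trans (+-congˡ (sym (coeff-⊞ q r i))) (sym (coeff-⊞ p (q ⊞ r) i)))))

  ⊞-comm : ∀ p q → p ⊞ q ≅ q ⊞ p
  ⊞-comm p q = wrap λ i →
    trans (coeff-⊞ p q i) (trans (+-comm _ _) (sym (coeff-⊞ q p i)))

  ⊞-identityʳ : ∀ p → p ⊞ [] ≅ p
  ⊞-identityʳ p = ⊞-comm p []

  ⊞-inverseʳ : ∀ p → p ⊞ ⊟ p ≅ []
  ⊞-inverseʳ p = wrap λ i →
    trans (coeff-⊞ p (⊟ p) i) (trans (+-congˡ (coeff-⊟ p i)) (-‿inverseʳ _))

  ⊞-interchange : ∀ p q r s → (p ⊞ q) ⊞ (r ⊞ s) ≅ (p ⊞ r) ⊞ (q ⊞ s)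
  ⊞-interchange p q r s = wrap λ i → trans (expand p q r s i)
    (trans (solve 4 (λ a b c d → (a :+ b) :+ (c :+ d) := (a :+ c) :+ (b :+ d)) refl _ _ _ _)
           (sym (expand p r q s i)))
    where
    expand : ∀ p q r s i → coeff ((p ⊞ q) ⊞ (r ⊞ s)) i ≈
             (coeff p i + coeff q i) + (coeff r i + coeff s i)
    expand p q r s i = trans (coeff-⊞ (p ⊞ q) (r ⊞ s) i) (+-cong (coeff-⊞ p q i) (coeff-⊞ r s i))

  scale-⊞ : ∀ a p q → map (a *_) (p ⊞ q) ≅ map (a *_) p ⊞ map (a *_) q
  scale-⊞ a p q = wrap λ i →
    trans (coeff-scale a (p ⊞ q) i) (trans (*-congˡ (coeff-⊞ p q i)) (trans (distribˡ a _ _)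
      (trans (sym (+-cong (coeff-scale a p i) (coeff-scale a q i)))
             (sym (coeff-⊞ (map (a *_) p) (map (a *_) q) i)))))

  scale-scale : ∀ a b p → map (a *_) (map (b *_) p) ≅ map (a * b *_) p
  scale-scale a b p = wrap λ i →
    trans (coeff-scale a (map (b *_) p) i) (trans (*-congˡ (coeff-scale b p i))
      (trans (sym (*-assoc a b _)) (sym (coeff-scale (a * b) p i))))

  scale-1 : ∀ p → map (1# *_) p ≅ p
  scale-1 p = wrap λ i → trans (coeff-scale 1# p i) (*-identityˡ _)

  scale-zero : ∀ {a} p → a ≈ 0# → map (a *_) p ≅ []
  scale-zero {a} p a≈0 = wrap λ i → trans (coeff-scale a p i) (trans (*-congʳ a≈0) (zeroˡ _))

  ⊠-zeroʳ : ∀ p → p ⊠ [] ≅ []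
  ⊠-zeroʳ []      = ≅.refl
  ⊠-zeroʳ (a ∷ p) = ∷-zero refl (⊠-zeroʳ p)

  -- `_⊠_` recurses on its left factor. This mirrored recursion on the right factor is what turns
  -- commutativity and `⊠-distribʳ` into plain inductions.
  ⊠-∷ʳ : ∀ p b q → p ⊠ (b ∷ q) ≅ map (b *_) p ⊞ (0# ∷ (p ⊠ q))
  ⊠-∷ʳ []      b q = ≅.sym (∷-zero refl ≅.refl)
  ⊠-∷ʳ (a ∷ p) b q = ∷-cong (+-congʳ (*-comm a b)) (begin
    map (a *_) q ⊞ (p ⊠ (b ∷ q))                    ≈⟨ ⊞-cong {map (a *_) q} ≅.refl (⊠-∷ʳ p b q) ⟩
    map (a *_) q ⊞ (map (b *_) p ⊞ (0# ∷ (p ⊠ q)))  ≈⟨ ⊞-assoc (map (a *_) q) _ _ ⟨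
    (map (a *_) q ⊞ map (b *_) p) ⊞ (0# ∷ (p ⊠ q))  ≈⟨ ⊞-cong (⊞-comm (map (a *_) q) _) ≅.refl ⟩
    (map (b *_) p ⊞ map (a *_) q) ⊞ (0# ∷ (p ⊠ q))  ≈⟨ ⊞-assoc (map (b *_) p) _ _ ⟩
    map (b *_) p ⊞ (map (a *_) q ⊞ (0# ∷ (p ⊠ q)))  ∎)

  ⊠-comm : ∀ p q → p ⊠ q ≅ q ⊠ p
  ⊠-comm []      q = ≅.sym (⊠-zeroʳ q)
  ⊠-comm (a ∷ p) q = begin
    map (a *_) q ⊞ (0# ∷ (p ⊠ q))  ≈⟨ ⊞-cong {map (a *_) q} ≅.refl (∷-cong refl (⊠-comm p q)) ⟩
    map (a *_) q ⊞ (0# ∷ (q ⊠ p))  ≈⟨ ⊠-∷ʳ q a p ⟨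
    q ⊠ (a ∷ p)                    ∎

  ⊠-congˡ : ∀ p {q r} → q ≅ r → p ⊠ q ≅ p ⊠ r
  ⊠-congˡ []      q≅r = ≅.refl
  ⊠-congˡ (a ∷ p) q≅r = ⊞-cong (scale-cong refl q≅r) (∷-cong refl (⊠-congˡ p q≅r))

  ⊠-cong : ∀ {p q r s} → p ≅ q → r ≅ s → p ⊠ r ≅ q ⊠ s
  ⊠-cong {p} {q} {r} {s} p≅q r≅s = begin
    p ⊠ r  ≈⟨ ⊠-congˡ p r≅s ⟩
    p ⊠ s  ≈⟨ ⊠-comm p s ⟩
    s ⊠ p  ≈⟨ ⊠-congˡ s p≅q ⟩
    s ⊠ q  ≈⟨ ⊠-comm s q ⟩
    q ⊠ s  ∎

  ⊠-distribʳ : ∀ r p q → (p ⊞ q) ⊠ r ≅ (p ⊠ r) ⊞ (q ⊠ r)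
  ⊠-distribʳ []      p q = begin
    (p ⊞ q) ⊠ []           ≈⟨ ⊠-zeroʳ (p ⊞ q) ⟩
    []                     ≈⟨ ⊞-cong (⊠-zeroʳ p) (⊠-zeroʳ q) ⟨
    (p ⊠ []) ⊞ (q ⊠ [])    ∎
  ⊠-distribʳ (c ∷ r) p q = begin
    (p ⊞ q) ⊠ (c ∷ r)
      ≈⟨ ⊠-∷ʳ (p ⊞ q) c r ⟩
    map (c *_) (p ⊞ q) ⊞ (0# ∷ ((p ⊞ q) ⊠ r))
      ≈⟨ ⊞-cong (scale-⊞ c p q) (∷-cong (sym (+-identityˡ 0#)) (⊠-distribʳ r p q)) ⟩
    (map (c *_) p ⊞ map (c *_) q) ⊞ ((0# ∷ (p ⊠ r)) ⊞ (0# ∷ (q ⊠ r)))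
      ≈⟨ ⊞-interchange (map (c *_) p) _ _ _ ⟩
    (map (c *_) p ⊞ (0# ∷ (p ⊠ r))) ⊞ (map (c *_) q ⊞ (0# ∷ (q ⊠ r)))
      ≈⟨ ⊞-cong (⊠-∷ʳ p c r) (⊠-∷ʳ q c r) ⟨
    (p ⊠ (c ∷ r)) ⊞ (q ⊠ (c ∷ r)) ∎

  scale-⊠ : ∀ a p q → map (a *_) p ⊠ q ≅ map (a *_) (p ⊠ q)
  scale-⊠ a []      q = ≅.refl
  scale-⊠ a (b ∷ p) q = begin
    map (a * b *_) q ⊞ (0# ∷ (map (a *_) p ⊠ q))
      ≈⟨ ⊞-cong (≅.sym (scale-scale a b q)) (∷-cong (sym (zeroʳ a)) (scale-⊠ a p q)) ⟩
    map (a *_) (map (b *_) q) ⊞ map (a *_) (0# ∷ (p ⊠ q))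
      ≈⟨ scale-⊞ a (map (b *_) q) _ ⟨
    map (a *_) (map (b *_) q ⊞ (0# ∷ (p ⊠ q))) ∎

  0∷-⊠ : ∀ p q → (0# ∷ p) ⊠ q ≅ 0# ∷ (p ⊠ q)
  0∷-⊠ p q = ⊞-cong (scale-zero q refl) ≅.refl

  ⊠-assoc : ∀ p q r → (p ⊠ q) ⊠ r ≅ p ⊠ (q ⊠ r)
  ⊠-assoc []      q r = ≅.refl
  ⊠-assoc (a ∷ p) q r = begin
    (map (a *_) q ⊞ (0# ∷ (p ⊠ q))) ⊠ r
      ≈⟨ ⊠-distribʳ r (map (a *_) q) _ ⟩
    (map (a *_) q ⊠ r) ⊞ ((0# ∷ (p ⊠ q)) ⊠ r)
      ≈⟨ ⊞-cong (scale-⊠ a q r) (0∷-⊠ (p ⊠ q) r) ⟩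
    map (a *_) (q ⊠ r) ⊞ (0# ∷ ((p ⊠ q) ⊠ r))
      ≈⟨ ⊞-cong {map (a *_) (q ⊠ r)} ≅.refl (∷-cong refl (⊠-assoc p q r)) ⟩
    map (a *_) (q ⊠ r) ⊞ (0# ∷ (p ⊠ (q ⊠ r))) ∎

  ⊠-identityˡ : ∀ p → 𝟙 ⊠ p ≅ p
  ⊠-identityˡ p = begin
    map (1# *_) p ⊞ (0# ∷ [])  ≈⟨ ⊞-cong (scale-1 p) (∷-zero refl ≅.refl) ⟩
    p ⊞ []                     ≈⟨ ⊞-identityʳ p ⟩
    p                          ∎

  poly-commutativeRing : CommutativeRing c ℓ
  poly-commutativeRing = record
    { Carrier = Poly
    ; _≈_     = _≅_
    ; _+_     = _⊞_
    ; _*_     = _⊠_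
    ; -_      = ⊟_
    ; 0#      = []
    ; 1#      = 𝟙
    ; isCommutativeRing = record
      { isRing = record
        { +-isAbelianGroup = record
          { isGroup = record
            { isMonoid = record
              { isSemigroup = record
                { isMagma = record { isEquivalence = ≅-isEquivalence ; ∙-cong = ⊞-cong }
                ; assoc   = ⊞-assoc
                }
              ; identity = (λ p → ≅.refl) , ⊞-identityʳ
              }
            ; inverse = (λ p → ≅.trans (⊞-comm (⊟ p) p) (⊞-inverseʳ p)) , ⊞-inverseʳ
            ; ⁻¹-cong = ⊟-cong
            }
          ; comm = ⊞-comm
          }
        ; *-cong     = ⊠-cong
        ; *-assoc    = ⊠-assoc
        ; *-identity = ⊠-identityˡ , λ p → ≅.trans (⊠-comm p 𝟙) (⊠-identityˡ p)
        ; distrib    = (λ r p q → ≅.trans (⊠-comm r (p ⊞ q)) (≅.trans (⊠-distribʳ r p q)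
                         (⊞-cong (⊠-comm p r) (⊠-comm q r)))) , ⊠-distribʳ
        }
      ; *-comm = ⊠-comm
      }
    }

  X⊠ : ∀ p → X ⊠ p ≅ 0# ∷ p
  X⊠ p = ≅.trans (0∷-⊠ 𝟙 p) (∷-cong refl (⊠-identityˡ p))

  map-zero : ∀ {a} {S : Set a} (f : S → Carrier) → (∀ s → f s ≈ 0#) → ∀ ss → map f ss ≅ []
  map-zero f f≈0 []       = ≅.refl
  map-zero f f≈0 (s ∷ ss) = ∷-zero (f≈0 s) (map-zero f f≈0 ss)

  map-⊞ : ∀ {a} {S : Set a} (f g : S → Carrier) ss → map (λ s → f s + g s) ss ≡ map f ss ⊞ map g ss
  map-⊞ f g []       = ≡.refl
  map-⊞ f g (s ∷ ss) = ≡.cong (f s + g s ∷_) (map-⊞ f g ss)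

  -- Each leading zero coefficient is one factor `X`. Vanishing is demanded only below `n`: in the
  -- application `f j` says whether a fixed class equals ℘ʲ, which is periodic in `j` and takes the
  -- value 1 again beyond `n`.
  monomial : ∀ (f : ℕ → Carrier) {k n} → k < n → f k ≈ 1# → (∀ j → j < n → ¬ j ≡ k → f j ≈ 0#) →
             applyUpTo f n ≅ X ^ k
  monomial f {zero}  (s≤s {n = n} k<n) fk≈1 f≈0 = ∷-cong fk≈1 (zeros (f ∘ suc) n λ j j<n → f≈0 (suc j) (s≤s j<n) λ ())
    where
    zeros : ∀ f n → (∀ j → j < n → f j ≈ 0#) → applyUpTo f n ≅ []
    zeros f zero    f≈0 = ≅.refl
    zeros f (suc n) f≈0 = ∷-zero (f≈0 0 (s≤s z≤n)) (zeros (f ∘ suc) n λ j j<n → f≈0 (suc j) (s≤s j<n))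
  monomial f {suc k} (s≤s {n = n} k<n) fk≈1 f≈0 = ≅.trans
    (∷-cong (f≈0 0 (s≤s z≤n) λ ())
      (monomial (f ∘ suc) k<n fk≈1 λ j j<n j≢k → f≈0 (suc j) (s≤s j<n) (j≢k ∘ ℕ.suc-injective)))
    (≅.sym (X⊠ (X ^ k)))

-- The quotient of a commutative ring by a principal ideal.

module QuotientRing {c ℓ} (R : CommutativeRing c ℓ) (m : CommutativeRing.Carrier R) where

  open CommutativeRing R
  open SemiringSolver commutativeSemiring using (solve; _:+_; _:*_; _:=_)
  open SetoidReasoning setoid
  private
    module R = RingProperties ring
    module + = AbelianGroupProperties +-abelianGroup

  infix 4 _≈ₘ_
  -- Written without subtraction, so that compatibility with sums and products is an identity of
  -- commutative semirings, within reach of the solver.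
  record _≈ₘ_ (x y : Carrier) : Set (c ⊔ ℓ) where
    constructor _,_
    field
      quotient : Carrier
      equality : x ≈ y + quotient * m

  ≈⇒≈ₘ : ∀ {x y} → x ≈ y → x ≈ₘ y
  ≈⇒≈ₘ {x} {y} x≈y = 0# , trans x≈y (sym (trans (+-congˡ (zeroˡ m)) (+-identityʳ y)))

  ≈ₘ-difference : ∀ {x y} ((t , _) : x ≈ₘ y) → t * m ≈ x - y
  ≈ₘ-difference {x} {y} (t , x≈y+tm) = begin
    t * m              ≈⟨ +.xyx⁻¹≈y y (t * m) ⟨
    y + t * m - y      ≈⟨ +-congʳ x≈y+tm ⟨
    x - y              ∎

  ≈ₘ-isEquivalence : IsEquivalence _≈ₘ_
  ≈ₘ-isEquivalence = record
    { refl  = ≈⇒≈ₘ refl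
    ; sym   = λ {x} {y} (t , x≈y+tm) → - t , (begin
        y                        ≈⟨ +-identityʳ y ⟨
        y + 0#                   ≈⟨ +-congˡ (-‿inverseʳ (t * m)) ⟨
        y + (t * m - t * m)      ≈⟨ +-assoc y _ _ ⟨
        (y + t * m) - t * m      ≈⟨ +-cong (sym x≈y+tm) (R.-‿distribˡ-* t m) ⟩
        x + - t * m              ∎)
    ; trans = λ {x} {y} {z} (s , x≈y+sm) (t , y≈z+tm) → t + s , (begin
        x                        ≈⟨ x≈y+sm ⟩
        y + s * m                ≈⟨ +-congʳ y≈z+tm ⟩
        (z + t * m) + s * m      ≈⟨ +-assoc z _ _ ⟩
        z + (t * m + s * m)      ≈⟨ +-congˡ (distribʳ m t s) ⟨
        z + (t + s) * m          ∎)
    }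

  private
    +-congₘ : ∀ {x y z w} → x ≈ₘ y → z ≈ₘ w → x + z ≈ₘ y + w
    +-congₘ {x} {y} {z} {w} (s , x≈y+sm) (t , z≈w+tm) = s + t , (begin
      x + z                        ≈⟨ +-cong x≈y+sm z≈w+tm ⟩
      (y + s * m) + (w + t * m)    ≈⟨ solve 5 (λ y w s t m →
        (y :+ s :* m) :+ (w :+ t :* m) := (y :+ w) :+ (s :+ t) :* m) refl y w s t m ⟩
      (y + w) + (s + t) * m        ∎)

    *-congₘ : ∀ {x y z w} → x ≈ₘ y → z ≈ₘ w → x * z ≈ₘ y * w
    *-congₘ {x} {y} {z} {w} (s , x≈y+sm) (t , z≈w+tm) = s * w + y * t + s * m * t , (begin
      x * z                                    ≈⟨ *-cong x≈y+sm z≈w+tm ⟩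
      (y + s * m) * (w + t * m)                ≈⟨ solve 5 (λ y w s t m →
        (y :+ s :* m) :* (w :+ t :* m) := y :* w :+ (s :* w :+ y :* t :+ s :* m :* t) :* m) refl y w s t m ⟩
      y * w + (s * w + y * t + s * m * t) * m  ∎)

    -‿congₘ : ∀ {x y} → x ≈ₘ y → - x ≈ₘ - y
    -‿congₘ {x} {y} (t , x≈y+tm) = - t , (begin
      - x              ≈⟨ -‿cong x≈y+tm ⟩
      - (y + t * m)    ≈⟨ +.⁻¹-∙-comm y (t * m) ⟨
      - y + - (t * m)  ≈⟨ +-congˡ (R.-‿distribˡ-* t m) ⟩
      - y + - t * m    ∎)

  quotientRing : CommutativeRing c (c ⊔ ℓ)
  quotientRing = record
    { Carrier = Carrier
    ; _≈_     = _≈ₘ_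
    ; _+_     = _+_
    ; _*_     = _*_
    ; -_      = -_
    ; 0#      = 0#
    ; 1#      = 1#
    ; isCommutativeRing = record
      { isRing = record
        { +-isAbelianGroup = record
          { isGroup = record
            { isMonoid = record
              { isSemigroup = record
                { isMagma = record { isEquivalence = ≈ₘ-isEquivalence ; ∙-cong = +-congₘ }
                ; assoc   = λ x y z → ≈⇒≈ₘ (+-assoc x y z)
                }
              ; identity = (λ x → ≈⇒≈ₘ (+-identityˡ x)) , (λ x → ≈⇒≈ₘ (+-identityʳ x))
              }
            ; inverse = (λ x → ≈⇒≈ₘ (-‿inverseˡ x)) , (λ x → ≈⇒≈ₘ (-‿inverseʳ x))
            ; ⁻¹-cong = -‿congₘ
            }
          ; comm = λ x y → ≈⇒≈ₘ (+-comm x y)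
          }
        ; *-cong     = *-congₘ
        ; *-assoc    = λ x y z → ≈⇒≈ₘ (*-assoc x y z)
        ; *-identity = (λ x → ≈⇒≈ₘ (*-identityˡ x)) , (λ x → ≈⇒≈ₘ (*-identityʳ x))
        ; distrib    = (λ x y z → ≈⇒≈ₘ (distribˡ x y z)) , (λ x y z → ≈⇒≈ₘ (distribʳ x y z))
        }
      ; *-comm = λ x y → ≈⇒≈ₘ (*-comm x y)
      }
    }

  modulus-difference : ∀ {x y} → m ≈ x - y → x ≈ₘ y
  modulus-difference {x} {y} m≈x-y = 1# , (begin
    x                  ≈⟨ +.xyx⁻¹≈y y x ⟨
    y + x - y          ≈⟨ +-assoc y x (- y) ⟩
    y + (x - y)        ≈⟨ +-congˡ (trans (*-identityˡ m) m≈x-y) ⟨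
    y + 1# * m         ∎)

-- Sums and products over initial segments of ℕ, cut into blocks.

module RangeSum {c ℓ} (M : CommutativeMonoid c ℓ) where

  open CommutativeMonoid M
  open Sum M public using (sum)
  open Sum M using (sum-cong-≋; ∑-distrib-+)
  open RawMonoidDefinitions rawMonoid using () renaming (_×_ to _·_)
  open SetoidReasoning setoid

  range : (ℕ → Carrier) → ℕ → Carrier
  range f n = sum {n} (f ∘ toℕ)

  range-cong : ∀ {f g} → (∀ k → f k ≈ g k) → ∀ n → range f n ≈ range g n
  range-cong f≈g n = sum-cong-≋ {n} λ i → f≈g (toℕ i)

  range-ε : ∀ {f} → (∀ k → f k ≈ ε) → ∀ n → range f n ≈ ε
  range-ε f≈ε zero    = refl
  range-ε f≈ε (suc n) = trans (∙-cong (f≈ε 0) (range-ε (f≈ε ∘ suc) n)) (identityˡ ε)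

  range-+ : ∀ f m n → range f (m ℕ.+ n) ≈ range f m ∙ range (λ k → f (m ℕ.+ k)) n
  range-+ f zero    n = sym (identityˡ _)
  range-+ f (suc m) n = trans (∙-congˡ (range-+ (f ∘ suc) m n)) (sym (assoc _ _ _))

  -- The indices are written k = j + i n with 0 ≤ j < n. It serves twice: multiplicatively for the
  -- factors of `F`, additively for the indices counted by `𝒢`.
  range-* : ∀ f m n → range f (m ℕ.* n) ≈ range (λ i → range (λ j → f (j ℕ.+ i ℕ.* n)) n) m
  range-* f zero    n = refl
  range-* f (suc m) n = begin
    range f (n ℕ.+ m ℕ.* n)
      ≈⟨ range-+ f n (m ℕ.* n) ⟩
    range f n ∙ range (λ k → f (n ℕ.+ k)) (m ℕ.* n)
      ≈⟨ ∙-cong (range-cong (λ j → reflexive (≡.cong f (≡.sym (ℕ.+-identityʳ j)))) n)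
                (range-* (λ k → f (n ℕ.+ k)) m n) ⟩
    range (λ j → f (j ℕ.+ 0)) n ∙ range (λ i → range (λ j → f (n ℕ.+ (j ℕ.+ i ℕ.* n))) n) m
      ≈⟨ ∙-congˡ (range-cong (λ i → range-cong (λ j → reflexive (≡.cong f (swap i j))) n) m) ⟩
    range (λ i → range (λ j → f (j ℕ.+ i ℕ.* n)) n) (suc m) ∎
    where
    swap : ∀ i j → n ℕ.+ (j ℕ.+ i ℕ.* n) ≡ j ℕ.+ (n ℕ.+ i ℕ.* n)
    swap i j = ≡.trans (≡.sym (ℕ.+-assoc n j _))
                 (≡.trans (≡.cong (ℕ._+ i ℕ.* n) (ℕ.+-comm n j)) (ℕ.+-assoc j n _))

  range-extend : ∀ {f m n} → m ≤ n → (∀ k → m ≤ k → f k ≈ ε) → range f n ≈ range f m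
  range-extend {f} {m} {n} m≤n f≈ε = begin
    range f n                                         ≡⟨ ≡.cong (range f) (≡.sym (ℕ.m+[n∸m]≡n m≤n)) ⟩
    range f (m ℕ.+ (n ℕ.∸ m))                         ≈⟨ range-+ f m (n ℕ.∸ m) ⟩
    range f m ∙ range (λ k → f (m ℕ.+ k)) (n ℕ.∸ m)   ≈⟨ ∙-congˡ (range-ε (λ k → f≈ε (m ℕ.+ k) (ℕ.m≤m+n m k)) (n ℕ.∸ m)) ⟩
    range f m ∙ ε                                     ≈⟨ identityʳ _ ⟩
    range f m                                         ∎

  sum-indicator : ∀ {n} (f : Fin n → Carrier) d →
                  sum (λ i → if does (i Fin.≟ d) then f i else ε) ≈ f d
  sum-indicator {suc n} f zero    = trans (∙-congˡ (range-ε {f = λ _ → ε} (λ _ → refl) n)) (identityʳ _)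
  sum-indicator         f (suc d) = trans (identityˡ _) (sum-indicator (f ∘ suc) d)

  -- In a multiplicative monoid `·` is exponentiation, so this is the step by which a product over
  -- the digits of n becomes a product of powers with exponents `e j n`. The multiplicity of `i`
  -- grows by one exactly when `i` is `d`.
  sum-multiplicity : ∀ {n} (f : Fin n → Carrier) d ds →
    sum (λ i → length (filter (i Fin.≟_) (d ∷ ds)) · f i) ≈
    f d ∙ sum (λ i → length (filter (i Fin.≟_) ds) · f i)
  sum-multiplicity f d ds = begin
    sum (λ i → length (filter (i Fin.≟_) (d ∷ ds)) · f i)
      ≈⟨ sum-cong-≋ step ⟩
    sum (λ i → (if does (i Fin.≟ d) then f i else ε) ∙ length (filter (i Fin.≟_) ds) · f i)
      ≈⟨ ∑-distrib-+ (λ i → if does (i Fin.≟ d) then f i else ε) _ ⟩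
    sum (λ i → if does (i Fin.≟ d) then f i else ε) ∙ sum (λ i → length (filter (i Fin.≟_) ds) · f i)
      ≈⟨ ∙-congʳ (sum-indicator f d) ⟩
    f d ∙ sum (λ i → length (filter (i Fin.≟_) ds) · f i) ∎
    where
    step : ∀ i → length (filter (i Fin.≟_) (d ∷ ds)) · f i ≈
                 (if does (i Fin.≟ d) then f i else ε) ∙ length (filter (i Fin.≟_) ds) · f i
    step i with i Fin.≟ d
    ... | yes _ = refl
    ... | no  _ = sym (identityˡ _)

-- Cancellation in fields and powers with a period.

module FieldProperties {c ℓ} (k : Field c ℓ) where

  open Field k hiding (zero)
  open Exp commutativeSemiring using (^-homo-*)
  open SetoidReasoning setoid
  module ∏ = RangeSum *-commutativeMonoid

  *-cancelˡ : ∀ {x y z} → ¬ x ≈ 0# → x * y ≈ x * z → y ≈ z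
  *-cancelˡ {x} {y} {z} x≉0 xy≈xz with x⁻¹ , x⁻¹x≈1 , _ ← invertible x x≉0 = begin
    y              ≈⟨ *-identityˡ y ⟨
    1# * y         ≈⟨ *-congʳ x⁻¹x≈1 ⟨
    x⁻¹ * x * y    ≈⟨ *-assoc _ x y ⟩
    x⁻¹ * (x * y)  ≈⟨ *-congˡ xy≈xz ⟩
    x⁻¹ * (x * z)  ≈⟨ *-assoc _ x z ⟨
    x⁻¹ * x * z    ≈⟨ *-congʳ x⁻¹x≈1 ⟩
    1# * z         ≈⟨ *-identityˡ z ⟩
    z              ∎

  *-cancelʳ : ∀ {x y z} → ¬ x ≈ 0# → y * x ≈ z * x → y ≈ z
  *-cancelʳ x≉0 yx≈zx = *-cancelˡ x≉0 (trans (*-comm _ _) (trans yx≈zx (*-comm _ _)))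

  *-nonzero : ∀ {x y} → ¬ x ≈ 0# → ¬ y ≈ 0# → ¬ x * y ≈ 0#
  *-nonzero x≉0 y≉0 xy≈0 = y≉0 (*-cancelˡ x≉0 (trans xy≈0 (sym (zeroʳ _))))

  ∏-nonzero : ∀ {n} (f : Fin n → Carrier) → (∀ i → ¬ f i ≈ 0#) → ¬ ∏.sum f ≈ 0#
  ∏-nonzero {zero}  f f≉0 = 1≉0
  ∏-nonzero {suc n} f f≉0 = *-nonzero (f≉0 zero) (∏-nonzero (f ∘ suc) (f≉0 ∘ suc))

  -- The form in which the Lucas congruence is read off: `u` and `v` come from the denominator and
  -- the numerator, `w` is their common factor, and `z` is the quotient of `e` by `d`.
  ratio : ∀ {x y z u v w d e} → ¬ w * d ≈ 0# →
          x * u ≈ y * v → u ≈ w * d → v ≈ w * e → z * d ≈ e → x ≈ z * y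
  ratio {x} {y} {z} {u} {v} {w} {d} {e} wd≉0 xu≈yv u≈wd v≈we zd≈e = *-cancelʳ wd≉0 (begin
    x * (w * d)        ≈⟨ *-congˡ u≈wd ⟨
    x * u              ≈⟨ xu≈yv ⟩
    y * v              ≈⟨ *-congˡ v≈we ⟩
    y * (w * e)        ≈⟨ *-congˡ (*-congˡ zd≈e) ⟨
    y * (w * (z * d))  ≈⟨ solve 4 (λ y w z d → y :* (w :* (z :* d)) := z :* y :* (w :* d)) refl y w z d ⟩
    z * y * (w * d)    ∎)
    where open SemiringSolver commutativeSemiring using (solve; _:*_; _:=_)

  ^-nonzero : ∀ {x} → ¬ x ≈ 0# → ∀ n → ¬ x ^ n ≈ 0#
  ^-nonzero x≉0 zero    = 1≉0
  ^-nonzero x≉0 (suc n) = *-nonzero x≉0 (^-nonzero x≉0 n)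

  ^-cancel : ∀ {x} → ¬ x ≈ 0# → ∀ {i j} → i ≤ j → x ^ i ≈ x ^ j → x ^ (j ℕ.∸ i) ≈ 1#
  ^-cancel {x} x≉0 {i} {j} i≤j xⁱ≈xʲ = *-cancelˡ (^-nonzero x≉0 i) (begin
    x ^ i * x ^ (j ℕ.∸ i)    ≈⟨ ^-homo-* x i (j ℕ.∸ i) ⟨
    x ^ (i ℕ.+ (j ℕ.∸ i))    ≡⟨ ≡.cong (x ^_) (ℕ.m+[n∸m]≡n i≤j) ⟩
    x ^ j                    ≈⟨ xⁱ≈xʲ ⟨
    x ^ i                    ≈⟨ *-identityʳ _ ⟨
    x ^ i * 1#               ∎)

module PeriodicPower {c ℓ} (A : CommutativeRing c ℓ) where

  open CommutativeRing A hiding (zero)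
  open Exp commutativeSemiring using (_^_; ^-homo-*; ^-assocʳ; ^-congˡ)
  open SetoidReasoning setoid

  1^n≈1 : ∀ n → 1# ^ n ≈ 1#
  1^n≈1 zero    = refl
  1^n≈1 (suc n) = trans (*-identityˡ _) (1^n≈1 n)

  ^-% : ∀ {x} d → x ^ suc d ≈ 1# → ∀ n → x ^ n ≈ x ^ (n % suc d)
  ^-% {x} d xᵈ≈1 n = begin
    x ^ n                                              ≡⟨ ≡.cong (x ^_) (m≡m%n+[m/n]*n n (suc d)) ⟩
    x ^ (n % suc d ℕ.+ (n / suc d) ℕ.* suc d)          ≈⟨ ^-homo-* x (n % suc d) _ ⟩
    x ^ (n % suc d) * x ^ ((n / suc d) ℕ.* suc d)      ≡⟨ ≡.cong (λ k → x ^ (n % suc d) * x ^ k) (ℕ.*-comm (n / suc d) (suc d)) ⟩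
    x ^ (n % suc d) * x ^ (suc d ℕ.* (n / suc d))      ≈⟨ *-congˡ (^-assocʳ x (suc d) (n / suc d)) ⟨
    x ^ (n % suc d) * (x ^ suc d) ^ (n / suc d)        ≈⟨ *-congˡ (trans (^-congˡ (n / suc d) xᵈ≈1) (1^n≈1 (n / suc d))) ⟩
    x ^ (n % suc d) * 1#                               ≈⟨ *-identityʳ _ ⟩
    x ^ (n % suc d)                                    ∎

-- Finite fields with a generator: its order, discrete logarithms and characters.

module FiniteFieldGenerator
  {c ℓ} (k : Field c ℓ) {p : ℕ} (class : Field.Carrier k → Fin (suc (suc p))) (rep : Fin (suc (suc p)) → Field.Carrier k)
  (class-correct : ∀ x → Field._≈_ k x (rep (class x)))
  (rep-injective : ∀ i j → Field._≈_ k (rep i) (rep j) → i ≡ j)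
  (rep-zero : Field._≈_ k (rep zero) (Field.0# k))
  (g : Field.Carrier k) (g≉0 : ¬ Field._≈_ k g (Field.0# k))
  (generates : ∀ x → ¬ Field._≈_ k x (Field.0# k) → ∃ λ e → Field._≈_ k x (Field.pow k g g≉0 e))
  where

  open Field k hiding (zero)
  open FieldProperties k
  open Exp commutativeSemiring using (^-homo-*; ^-assocʳ; ^-congˡ)
  open PeriodicPower commutativeRing
  open SetoidReasoning setoid

  class-injective : ∀ {x y} → class x ≡ class y → x ≈ y
  class-injective {x} {y} eq = begin
    x              ≈⟨ class-correct x ⟩
    rep (class x)  ≡⟨ ≡.cong rep eq ⟩
    rep (class y)  ≈⟨ class-correct y ⟨
    y              ∎

  class-cong : ∀ {x y} → x ≈ y → class x ≡ class y
  class-cong {x} {y} x≈y = rep-injective _ _ (begin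
    rep (class x)  ≈⟨ class-correct x ⟨
    x              ≈⟨ x≈y ⟩
    y              ≈⟨ class-correct y ⟩
    rep (class y)  ∎)

  infix 4 _≈?_
  _≈?_ : ∀ x y → Dec (x ≈ y)
  x ≈? y with class x Fin.≟ class y
  ... | yes eq = yes (class-injective eq)
  ... | no  ne = no (ne ∘ class-cong)

  private
    zero≢class : ∀ {x} → ¬ x ≈ 0# → ¬ zero ≡ class x
    zero≢class {x} x≉0 eq = x≉0 (begin
      x              ≈⟨ class-correct x ⟩
      rep (class x)  ≡⟨ ≡.cong rep eq ⟨
      rep zero       ≈⟨ rep-zero ⟩
      0#             ∎)

    power≢0 : ∀ (i : Fin (suc (suc p))) → ¬ zero ≡ class (g ^ toℕ i)
    power≢0 i = zero≢class (^-nonzero g≉0 (toℕ i))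

    rep-suc≉0 : ∀ i → ¬ rep (suc i) ≈ 0#
    rep-suc≉0 i eq with () ← rep-injective (suc i) zero (trans eq (sym rep-zero))

  -- Stated for an arbitrary period `suc d`, because it serves to bound every period from below
  -- before the order of `g` is known. Negative exponents are removed by g⁻¹ = gᵈ.
  log-period : ∀ d → g ^ suc d ≈ 1# → ∀ x → ¬ x ≈ 0# → ∃ λ i → i < suc d × x ≈ g ^ i
  log-period d gᵈ≈1 x x≉0 = reduce (generates x x≉0)
    where
    g⁻¹≈gᵈ : inv g g≉0 ≈ g ^ d
    g⁻¹≈gᵈ = *-cancelˡ g≉0 (trans (proj₂ (proj₂ (invertible g g≉0))) (sym gᵈ≈1))

    reduce : (∃ λ e → x ≈ pow g g≉0 e) → ∃ λ i → i < suc d × x ≈ g ^ i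
    reduce (+ n      , x≈) = n % suc d , m%n<n n (suc d) , trans x≈ (^-% d gᵈ≈1 n)
    reduce (-[1+ n ] , x≈) = m % suc d , m%n<n m (suc d) , (begin
      x                    ≈⟨ x≈ ⟩
      inv g g≉0 ^ suc n    ≈⟨ ^-congˡ (suc n) g⁻¹≈gᵈ ⟩
      (g ^ d) ^ suc n      ≈⟨ ^-assocʳ g d (suc n) ⟩
      g ^ m                ≈⟨ ^-% d gᵈ≈1 m ⟩
      g ^ (m % suc d)      ∎)
      where m = d ℕ.* suc n

  -- The q - 1 nonzero representatives have distinct logarithms below any period.
  period-lower-bound : ∀ d → g ^ suc d ≈ 1# → suc p ≤ suc d
  period-lower-bound d gᵈ≈1 = Fin.injective⇒≤ {f = exponent} λ {i} {j} eq →
    Fin.suc-injective (rep-injective _ _ (begin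
      rep (suc i)         ≈⟨ proj₂ (proj₂ (log i)) ⟩
      g ^ proj₁ (log i)   ≡⟨ ≡.cong (g ^_) (Fin.fromℕ<-injective _ _ _ _ eq) ⟩
      g ^ proj₁ (log j)   ≈⟨ proj₂ (proj₂ (log j)) ⟨
      rep (suc j)         ∎))
    where
    log : ∀ i → ∃ λ e → e < suc d × rep (suc i) ≈ g ^ e
    log i = log-period d gᵈ≈1 (rep (suc i)) (rep-suc≉0 i)
    exponent : Fin (suc p) → Fin (suc d)
    exponent i = fromℕ< (proj₁ (proj₂ (log i)))

  -- The q powers g⁰, ..., g^(q-1) avoid the class of 0, which `punchOut` deletes, so two of them
  -- share one of the q - 1 remaining classes. Their exponents differ by at most q - 1.
  period-exists : ∃ λ d → suc d ≤ suc p × g ^ suc d ≈ 1#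
  period-exists with i , j , i<j , eq ← Fin.pigeonhole ℕ.≤-refl (punchOut ∘ power≢0)
    = difference (toℕ j ℕ.∸ toℕ i) ≡.refl
    where
    gᵈ≈1 : g ^ (toℕ j ℕ.∸ toℕ i) ≈ 1#
    gᵈ≈1 = ^-cancel g≉0 (ℕ.<⇒≤ i<j) (class-injective (Fin.punchOut-injective (power≢0 i) (power≢0 j) eq))

    difference : ∀ d → d ≡ toℕ j ℕ.∸ toℕ i → ∃ λ d → suc d ≤ suc p × g ^ suc d ≈ 1#
    difference zero    d≡ = contradiction (≡.sym d≡) (ℕ.m>n⇒m∸n≢0 i<j)
    difference (suc d) d≡ = d
      , ≡.subst (_≤ suc p) (≡.sym d≡) (ℕ.≤-trans (ℕ.m∸n≤m (toℕ j) (toℕ i)) (ℕ.≤-pred (Fin.toℕ<n j)))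
      , trans (reflexive (≡.cong (g ^_) d≡)) gᵈ≈1

  g^[q-1]≈1 : g ^ suc p ≈ 1#
  g^[q-1]≈1 with d , d≤ , gᵈ≈1 ← period-exists =
    ≡.subst (λ d → g ^ d ≈ 1#) (ℕ.≤-antisym d≤ (period-lower-bound d gᵈ≈1)) gᵈ≈1

  log : ∀ x → ¬ x ≈ 0# → ∃ λ i → i < suc p × x ≈ g ^ i
  log = log-period p g^[q-1]≈1

  private
    ^-distinct : ∀ {i j} → i < j → j < suc p → ¬ g ^ i ≈ g ^ j
    ^-distinct {i} {j} i<j j<q-1 eq = step (j ℕ.∸ i) (ℕ.m>n⇒m∸n≢0 i<j)
      (ℕ.≤-<-trans (ℕ.m∸n≤m j i) j<q-1) (^-cancel g≉0 (ℕ.<⇒≤ i<j) eq)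
      where
      step : ∀ d → ¬ d ≡ 0 → d < suc p → ¬ g ^ d ≈ 1#
      step zero    d≢0 _   _    = d≢0 ≡.refl
      step (suc d) _   d<p gᵈ≈1 = ℕ.≤⇒≯ (period-lower-bound d gᵈ≈1) d<p

  ^-injective : ∀ {i j} → i < suc p → j < suc p → g ^ i ≈ g ^ j → i ≡ j
  ^-injective {i} {j} i< j< eq with ℕ.<-cmp i j
  ... | tri< i<j _ _ = contradiction eq (^-distinct i<j j<)
  ... | tri≈ _ i≡j _ = i≡j
  ... | tri> _ _ j<i = contradiction (sym eq) (^-distinct j<i i<)

  -- x ↦ d - x permutes the field and swaps d and 0.
  ∏-differences : ∀ d → ∏.sum (λ i → rep d - rep (punchIn d i)) ≈ ∏.sum (λ i → rep (suc i))
  ∏-differences d = begin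
    ∏.sum (λ i → rep d - rep (punchIn d i))
      ≈⟨ Sum.sum-cong-≋ *-commutativeMonoid (λ i → trans (class-correct _)
           (reflexive (≡.cong rep (≡.trans (punchIn-permute σ d i) (≡.cong (λ j → punchIn j (remove d σ ⟨$⟩ʳ i)) σd≡0))))) ⟩
    ∏.sum (λ i → rep (suc (remove d σ ⟨$⟩ʳ i)))
      ≈⟨ Sum.sum-permute *-commutativeMonoid (rep ∘ suc) (remove d σ) ⟨
    ∏.sum (λ i → rep (suc i)) ∎
    where
    reflect : Fin (suc (suc p)) → Fin (suc (suc p))
    reflect i = class (rep d - rep i)

    module + = AbelianGroupProperties +-abelianGroup

    reflect-involutive : ∀ i → reflect (reflect i) ≡ i
    reflect-involutive i = rep-injective _ _ (begin
      rep (reflect (reflect i))     ≈⟨ class-correct _ ⟨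
      rep d - rep (reflect i)       ≈⟨ +-congˡ (-‿cong (class-correct _)) ⟨
      rep d - (rep d - rep i)       ≈⟨ +-congˡ (+.⁻¹-anti-homo-// (rep d) (rep i)) ⟩
      rep d + (rep i - rep d)       ≈⟨ +-assoc _ _ _ ⟨
      rep d + rep i - rep d         ≈⟨ +.xyx⁻¹≈y (rep d) (rep i) ⟩
      rep i                         ∎)

    σ : Permutation′ (suc (suc p))
    σ = permutation reflect reflect reflect-involutive reflect-involutive

    σd≡0 : reflect d ≡ zero
    σd≡0 = rep-injective _ _ (begin
      rep (reflect d)   ≈⟨ class-correct _ ⟨
      rep d - rep d     ≈⟨ -‿inverseʳ (rep d) ⟩
      0#                ≈⟨ rep-zero ⟨
      rep zero          ∎)

  ∏-units-nonzero : ¬ ∏.sum (λ i → rep (suc i)) ≈ 0#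
  ∏-units-nonzero = ∏-nonzero (rep ∘ suc) rep-suc≉0

  zero-or-power : ∀ x → x ≈ 0# ⊎ ∃ λ i → i < suc p × x ≈ g ^ i
  zero-or-power x with x ≈? 0#
  ... | yes x≈0 = inj₁ x≈0
  ... | no x≉0  = inj₂ (log x x≉0)

  module Character {a b} (A : CommutativeRing a b) (ζ : CommutativeRing.Carrier A)
    (ζ^[q-1]≈1 : CommutativeRing._≈_ A (Exp._^_ (CommutativeRing.commutativeSemiring A) ζ (suc p)) (CommutativeRing.1# A))
    where

    private
      module A where
        open CommutativeRing A public
        open Exp (CommutativeRing.commutativeSemiring A) public using (_^_; ^-homo-*)
        open PeriodicPower A public using (^-%)

    -- The value 0 at 0 is forced by the application: an index m with F_m(u_n) in 𝔪 is counted by no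
    -- ε_j.
    χ : Carrier → A.Carrier
    χ x with zero-or-power x
    ... | inj₁ _       = A.0#
    ... | inj₂ (i , _) = ζ A.^ i

    χ-zero : ∀ {x} → x ≈ 0# → χ x A.≈ A.0#
    χ-zero {x} x≈0 with zero-or-power x
    ... | inj₁ _            = A.refl
    ... | inj₂ (i , _ , x≈) = contradiction (trans (sym x≈) x≈0) (^-nonzero g≉0 i)

    -- `χ` is defined by the logarithm below q - 1; any other exponent will do because `g` and `ζ`
    -- share the period q - 1. Multiplicativity can then simply add logarithms.
    χ-power : ∀ {x} k → x ≈ g ^ k → χ x A.≈ ζ A.^ k
    χ-power {x} k x≈gᵏ with zero-or-power x
    ... | inj₁ x≈0              = contradiction (trans (sym x≈gᵏ) x≈0) (^-nonzero g≉0 k)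
    ... | inj₂ (i , i< , x≈gⁱ)  = A.sym (A.trans (A.^-% p ζ^[q-1]≈1 k) (A.reflexive (≡.cong (ζ A.^_)
      (^-injective (m%n<n k (suc p)) i<
        (trans (sym (^-% p g^[q-1]≈1 k)) (trans (sym x≈gᵏ) x≈gⁱ))))))

    χ-cong : ∀ {x y} → x ≈ y → χ x A.≈ χ y
    χ-cong {x} {y} x≈y = by-cases (zero-or-power y)
      where
      by-cases : y ≈ 0# ⊎ (∃ λ i → i < suc p × y ≈ g ^ i) → χ x A.≈ χ y
      by-cases (inj₁ y≈0)          = A.trans (χ-zero (trans x≈y y≈0)) (A.sym (χ-zero y≈0))
      by-cases (inj₂ (i , _ , y≈)) = A.trans (χ-power i (trans x≈y y≈)) (A.sym (χ-power i y≈))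

    χ-* : ∀ x y → χ (x * y) A.≈ χ x A.* χ y
    χ-* x y = by-cases (zero-or-power x) (zero-or-power y)
      where
      by-cases : x ≈ 0# ⊎ (∃ λ i → i < suc p × x ≈ g ^ i) → y ≈ 0# ⊎ (∃ λ i → i < suc p × y ≈ g ^ i) →
                 χ (x * y) A.≈ χ x A.* χ y
      by-cases (inj₁ x≈0) _ = A.trans (χ-zero (trans (*-congʳ x≈0) (zeroˡ y)))
        (A.sym (A.trans (A.*-congʳ (χ-zero x≈0)) (A.zeroˡ (χ y))))
      by-cases (inj₂ _) (inj₁ y≈0) = A.trans (χ-zero (trans (*-congˡ y≈0) (zeroʳ x)))
        (A.sym (A.trans (A.*-congˡ (χ-zero y≈0)) (A.zeroʳ (χ x))))
      by-cases (inj₂ (i , _ , x≈)) (inj₂ (j , _ , y≈)) = A.trans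
        (χ-power (i ℕ.+ j) (trans (*-cong x≈ y≈) (sym (^-homo-* g i j))))
        (A.trans (A.^-homo-* ζ i j) (A.sym (A.*-cong (χ-power i x≈) (χ-power j y≈))))

-- The residue field V/𝔪.

module ResidueField {c ℓ} (V : DiscreteValuationDomain c ℓ) where

  open DiscreteValuationDomain V hiding (zero)
  open ValuationProperties V
  private
    module K = RingProperties ring
    module K∏ = RangeSum *-commutativeMonoid

  infix 4 _≈κ_
  -- The congruence mentions only the underlying elements of K; wrapping it in a record lets the
  -- membership proofs be inferred as well.
  record _≈κ_ (x y : ∃ _∈V) : Set ℓ where
    constructor mod𝔪
    field congruent : proj₁ x ≡ proj₁ y [𝔪]
  open _≈κ_ public

  ≈⇒≈κ : ∀ {x y} → proj₁ x ≈ proj₁ y → x ≈κ y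
  ≈⇒≈κ x≈y = mod𝔪 (∈𝔪-cong (+-congˡ (-‿cong x≈y)) ≡𝔪-refl)

  ≈κ-isEquivalence : IsEquivalence _≈κ_
  ≈κ-isEquivalence = record
    { refl  = mod𝔪 ≡𝔪-refl
    ; sym   = λ (mod𝔪 e) → mod𝔪 (≡𝔪-sym e)
    ; trans = λ (mod𝔪 e) (mod𝔪 f) → mod𝔪 (≡𝔪-trans e f)
    }

  private
    infixl 6 _+κ_
    infixl 7 _*κ_
    _+κ_ _*κ_ : ∃ _∈V → ∃ _∈V → ∃ _∈V
    (x , x∈V) +κ (y , y∈V) = x + y , V-+ x∈V y∈V
    (x , x∈V) *κ (y , y∈V) = x * y , V-* x∈V y∈V

    -κ_ : ∃ _∈V → ∃ _∈V
    -κ (x , x∈V) = - x , V-neg x∈V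

    +κ-cong : ∀ {x y z w} → x ≈κ y → z ≈κ w → x +κ z ≈κ y +κ w
    +κ-cong {x , _} {y , _} {z , _} {w , _} (mod𝔪 x≡y) (mod𝔪 z≡w) = mod𝔪 (∈𝔪-cong
      (trans (interchange x (- y) z (- w)) (+-congˡ (+P.⁻¹-∙-comm y w))) (𝔪-+ x≡y z≡w))
      where
      open CommutativeSemigroupProperties
        (CommutativeMonoid.commutativeSemigroup +-commutativeMonoid) using (interchange)

    *κ-congʳ : ∀ {x y} z → x ≈κ y → x *κ z ≈κ y *κ z
    *κ-congʳ {x , _} {y , _} (z , z∈V) (mod𝔪 x≡y) = mod𝔪 (∈𝔪-cong (K.[y-z]x≈yx-zx z x y) (𝔪-* x≡y z∈V))

    *κ-comm : ∀ x y → x *κ y ≈κ y *κ x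
    *κ-comm (x , _) (y , _) = ≈⇒≈κ (*-comm x y)

    *κ-cong : ∀ {x y z w} → x ≈κ y → z ≈κ w → x *κ z ≈κ y *κ w
    *κ-cong {x} {y} {z} {w} x≈y z≈w = IsEquivalence.trans ≈κ-isEquivalence (*κ-congʳ z x≈y)
      (IsEquivalence.trans ≈κ-isEquivalence (*κ-comm y z)
        (IsEquivalence.trans ≈κ-isEquivalence (*κ-congʳ y z≈w) (*κ-comm w y)))

    -κ-cong : ∀ {x y} → x ≈κ y → -κ x ≈κ -κ y
    -κ-cong {x , _} {y , _} (mod𝔪 x≡y) = mod𝔪 (∈𝔪-cong (sym (+P.⁻¹-∙-comm x (- y))) (𝔪-neg x≡y))

  residueRing : CommutativeRing _ ℓ
  residueRing = record
    { Carrier = ∃ _∈V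
    ; _≈_     = _≈κ_
    ; _+_     = _+κ_
    ; _*_     = _*κ_
    ; -_      = -κ_
    ; 0#      = 0# , 0∈V
    ; 1#      = 1# , 1∈V
    ; isCommutativeRing = record
      { isRing = record
        { +-isAbelianGroup = record
          { isGroup = record
            { isMonoid = record
              { isSemigroup = record
                { isMagma = record { isEquivalence = ≈κ-isEquivalence ; ∙-cong = +κ-cong }
                ; assoc   = λ (x , _) (y , _) (z , _) → ≈⇒≈κ (+-assoc x y z)
                }
              ; identity = (λ (x , _) → ≈⇒≈κ (+-identityˡ x)) , (λ (x , _) → ≈⇒≈κ (+-identityʳ x))
              }
            ; inverse = (λ (x , _) → ≈⇒≈κ (-‿inverseˡ x)) , (λ (x , _) → ≈⇒≈κ (-‿inverseʳ x))
            ; ⁻¹-cong = -κ-cong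
            }
          ; comm = λ (x , _) (y , _) → ≈⇒≈κ (+-comm x y)
          }
        ; *-cong     = *κ-cong
        ; *-assoc    = λ (x , _) (y , _) (z , _) → ≈⇒≈κ (*-assoc x y z)
        ; *-identity = (λ (x , _) → ≈⇒≈κ (*-identityˡ x)) , (λ (x , _) → ≈⇒≈κ (*-identityʳ x))
        ; distrib    = (λ (x , _) (y , _) (z , _) → ≈⇒≈κ (distribˡ x y z))
                     , (λ (x , _) (y , _) (z , _) → ≈⇒≈κ (distribʳ x y z))
        }
      ; *-comm = *κ-comm
      }
    }

  ≈κ0⇒∈𝔪 : ∀ {x} → x ≈κ (0# , 0∈V) → proj₁ x ∈𝔪
  ≈κ0⇒∈𝔪 (mod𝔪 x≡0) = ∈𝔪-cong (trans (+-congˡ +P.ε⁻¹≈ε) (+-identityʳ _)) x≡0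

  ∈𝔪⇒≈κ0 : ∀ {x} → proj₁ x ∈𝔪 → x ≈κ (0# , 0∈V)
  ∈𝔪⇒≈κ0 x∈𝔪 = mod𝔪 (∈𝔪-cong (sym (trans (+-congˡ +P.ε⁻¹≈ε) (+-identityʳ _))) x∈𝔪)

  ≉κ0⇒≉0 : ∀ {x} → ¬ x ≈κ (0# , 0∈V) → ¬ proj₁ x ≈ 0#
  ≉κ0⇒≉0 x≉κ0 x≈0 = x≉κ0 (≈⇒≈κ x≈0)

  residueField : Field _ ℓ
  residueField = record
    { commutativeRing = residueRing
    ; 1≉0             = 1∉𝔪 ∘ ≈κ0⇒∈𝔪
    ; invertible      = λ (x , x∈V) x≉κ0 →
        let x≉0 = ≉κ0⇒≉0 {x , x∈V} x≉κ0 in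
        (inv x x≉0 , inv∈V x∈V (x≉κ0 ∘ ∈𝔪⇒≈κ0) x≉0)
        , ≈⇒≈κ (inverseˡ* x x≉0) , ≈⇒≈κ (inverseʳ* x x≉0)
    }

  module κ = Field residueField
  module κ∏ = RangeSum κ.*-commutativeMonoid

  -- Products of elements of V are manipulated in K and reduced modulo 𝔪 afterwards; this is the
  -- passage between the two readings.
  proj₁-∏ : ∀ {n} (f : Fin n → ∃ _∈V) → K∏.sum (proj₁ ∘ f) ≡ proj₁ (κ∏.sum f)
  proj₁-∏ {zero}  f = ≡.refl
  proj₁-∏ {suc n} f = ≡.cong (proj₁ (f zero) *_) (proj₁-∏ (f ∘ suc))

  proj₁-^ : ∀ x n → proj₁ (x κ.^ n) ≡ proj₁ x ^ n
  proj₁-^ x zero    = ≡.refl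
  proj₁-^ x (suc n) = ≡.cong (proj₁ x *_) (proj₁-^ x n)

  proj₁-pow : ∀ x (x≉κ0 : ¬ x κ.≈ κ.0#) (x≉0 : ¬ proj₁ x ≈ 0#) e →
              proj₁ (κ.pow x x≉κ0 e) ≡ pow (proj₁ x) x≉0 e
  proj₁-pow x x≉κ0 x≉0 (+ n)    = proj₁-^ x n
  proj₁-pow x x≉κ0 x≉0 -[1+ n ] = proj₁-^ (κ.inv x x≉κ0) (suc n)

  -- The source of integrality for the values of `F`, which are known only through their product
  -- with a unit of V.
  unit-quotient∈V : ∀ {z} x y → ¬ y κ.≈ κ.0# → z * proj₁ y ≈ proj₁ x → z ∈V
  unit-quotient∈V {z} (x , x∈V) (y , y∈V) y≉κ0 zy≈x = ∈V-cong (begin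
    x * inv y y≉0        ≈⟨ *-congʳ zy≈x ⟨
    z * y * inv y y≉0    ≈⟨ *-assoc z y _ ⟩
    z * (y * inv y y≉0)  ≈⟨ *-congˡ (inverseʳ* y y≉0) ⟩
    z * 1#               ≈⟨ *-identityʳ z ⟩
    z                    ∎) (V-* x∈V (inv∈V y∈V (y≉κ0 ∘ ∈𝔪⇒≈κ0) y≉0))
    where
    open SetoidReasoning setoid
    y≉0 = ≉κ0⇒≉0 {y , y∈V} y≉κ0

-- The Lucas congruence for the values F_m(u_n).

module Lucas {c ℓ} (V : DiscreteValuationDomain c ℓ) {p : ℕ} (R : Representatives V (suc (suc p)))
             (Π : Uniformizer V) (G : PrimitiveElement V) where

  open DiscreteValuationDomain V hiding (zero)
  open Representatives R
  open Uniformizer Π using (π)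
  open PrimitiveElement G using (℘; ℘∈V; ℘∉𝔪; ℘≉0; generates)
  open ValuationProperties V using (y≈0⇒xy≈0; x≈0⇒xy≈0; inverseʳ*; ∈V-cong; 1∈V; 0∈V)
  open RepresentativesProperties V R
  open Construction V R Π G
  open ResidueField V public
  open FieldProperties K
  private
    module κF = FieldProperties residueField
    module + = AbelianGroupProperties +-abelianGroup
    module K = RingProperties ring

  q : ℕ
  q = suc (suc p)

  repκ : Fin q → κ.Carrier
  repκ i = rep i , rep∈V i

  ℘κ : κ.Carrier
  ℘κ = ℘ , ℘∈V

  ℘κ≉0 : ¬ ℘κ κ.≈ κ.0#
  ℘κ≉0 = ℘∉𝔪 ∘ ≈κ0⇒∈𝔪

  ℘κ-generates : ∀ x → ¬ x κ.≈ κ.0# → ∃ λ e → x κ.≈ κ.pow ℘κ ℘κ≉0 e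
  ℘κ-generates (x , x∈V) x≉κ0 with e , x≡ ← generates x x∈V (x≉κ0 ∘ ∈𝔪⇒≈κ0) =
    e , mod𝔪 (≡.subst (λ y → x ≡ y [𝔪]) (≡.sym (proj₁-pow ℘κ ℘κ≉0 ℘≉0 e)) x≡)

  open FiniteFieldGenerator residueField (λ (_ , x∈V) → class x∈V) repκ
    (λ (x , x∈V) → mod𝔪 (proj₂ (complete x x∈V))) (λ i j → distinct i j ∘ congruent)
    (≈⇒≈κ (rep₀ zero ≡.refl)) ℘κ ℘κ≉0 ℘κ-generates public

  digit-unique : ∀ (d e : Fin q) {m n} → toℕ d ℕ.+ m ℕ.* q ≡ toℕ e ℕ.+ n ℕ.* q → d ≡ e × m ≡ n
  digit-unique d e {m} {n} eq = Fin.toℕ-injective d≡e , ℕ.*-cancelʳ-≡ m n q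
    (ℕ.+-cancelˡ-≡ (toℕ e) _ _ (≡.subst (λ k → k ℕ.+ m ℕ.* q ≡ toℕ e ℕ.+ n ℕ.* q) d≡e eq))
    where
    digit : ∀ (d : Fin q) m → (toℕ d ℕ.+ m ℕ.* q) % q ≡ toℕ d
    digit d m = ≡.trans ([m+kn]%n≡m%n (toℕ d) m q) (m<n⇒m%n≡m (Fin.toℕ<n d))
    d≡e : toℕ d ≡ toℕ e
    d≡e = ≡.trans (≡.sym (digit d m)) (≡.trans (≡.cong (_% q) eq) (digit e n))

  open SetoidReasoning setoid

  private
    zero-digit : ∀ {y} → y ≈ 0# → 0# ≈ rep zero + π * y
    zero-digit y≈0 = sym (trans (+-cong (rep₀ zero ≡.refl) (y≈0⇒xy≈0 y≈0)) (+-identityˡ 0#))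

  value-zero : ∀ ds → fromDigits ds ≡ 0 → 0# ≈ value Π ds
  value-zero []       eq = refl
  value-zero (d ∷ ds) eq with ≡.refl , eq′ ← digit-unique d zero {fromDigits ds} {0} eq =
    zero-digit (sym (value-zero ds eq′))

  value-cong : ∀ ds es → fromDigits ds ≡ fromDigits es → value Π ds ≈ value Π es
  value-cong []       es       eq = value-zero es (≡.sym eq)
  value-cong (d ∷ ds) []       eq = sym (value-zero (d ∷ ds) eq)
  value-cong (d ∷ ds) (e ∷ es) eq with ≡.refl , eq′ ← digit-unique d e {fromDigits ds} {fromDigits es} eq =
    +-congˡ (*-congˡ (value-cong ds es eq′))

  u-step : ∀ d n → u (toℕ d ℕ.+ n ℕ.* q) ≈ rep d + π * u n
  u-step d n = value-cong (digits (toℕ d ℕ.+ n ℕ.* q)) (d ∷ digits n)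
    (≡.trans (proj₂ (toDigits q _)) (≡.cong (λ k → toℕ d ℕ.+ k ℕ.* q) (≡.sym (proj₂ (toDigits q n)))))

  uκ : ℕ → κ.Carrier
  uκ n = u n , value∈V Π (digits n)

  uκ-step : ∀ d n → uκ (toℕ d ℕ.+ n ℕ.* q) κ.≈ repκ d
  uκ-step d n = κ.trans
    (≈⇒≈κ {uκ (toℕ d ℕ.+ n ℕ.* q)} {value Π (d ∷ digits n) , value∈V Π (d ∷ digits n)} (u-step d n))
    (mod𝔪 (value-≡𝔪 Π d (digits n)))

  uκ-digit : ∀ d → uκ (toℕ d) κ.≈ repκ d
  uκ-digit d = ≡.subst (λ k → uκ k κ.≈ repκ d) (ℕ.+-identityʳ (toℕ d)) (uκ-step d 0)

  N : ℕ → Carrier → Carrier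
  N m x = ∏.range (λ k → x - u k) m

  D : ℕ → Carrier
  D m = N m (u m)

  D≉0 : ∀ m → ¬ D m ≈ 0#
  D≉0 m = ∏-nonzero (λ i → u m - u (toℕ i)) λ i → u-distinct {toℕ i} {m} (Fin.toℕ<n i)

  F⟨_⟩ : ℕ → Carrier → Carrier
  F⟨ m ⟩ = K[x].eval (F m)

  F*D≈N : ∀ m x → F⟨ m ⟩ x * D m ≈ N m x
  F*D≈N m x = step (λ i → u m - u (toℕ i)) (u ∘ toℕ) (λ i → u-distinct {toℕ i} {m} (Fin.toℕ<n i))
    where
    open K[x] using (eval; product; const; _⊠_; _⊖_; X; eval-⊠; eval-const; eval-X⊖const)
    open SemiringSolver commutativeSemiring using (solve; _:*_; _:=_)
    -- The denominators and roots become arbitrary families, since the denominators u_m - u_k all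
    -- change with m and an induction on m itself would fail.
    step : ∀ {n} (d r : Fin n → Carrier) (d≉0 : ∀ i → ¬ d i ≈ 0#) →
           eval (product λ i → const (inv (d i) (d≉0 i)) ⊠ (X ⊖ const (r i))) x * ∏.sum d ≈
           ∏.sum (λ i → x - r i)
    step {zero}  d r d≉0 = trans (*-identityʳ _) (eval-const 1# x)
    step {suc n} d r d≉0 = begin
      eval (l₀ ⊠ product ls) x * (d₀ * ds)
        ≈⟨ *-congʳ (trans (eval-⊠ l₀ (product ls) x) (*-congʳ (trans (eval-⊠ (const i₀) (X ⊖ const (r zero)) x)
             (*-cong (eval-const i₀ x) (eval-X⊖const (r zero) x))))) ⟩
      i₀ * (x - r zero) * eval (product ls) x * (d₀ * ds)
        ≈⟨ solve 5 (λ i y e d₀ ds → i :* y :* e :* (d₀ :* ds) := d₀ :* i :* (y :* (e :* ds)))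
             refl i₀ (x - r zero) (eval (product ls) x) d₀ ds ⟩
      d₀ * i₀ * ((x - r zero) * (eval (product ls) x * ds))
        ≈⟨ *-congʳ (inverseʳ* d₀ (d≉0 zero)) ⟩
      1# * ((x - r zero) * (eval (product ls) x * ds))
        ≈⟨ *-identityˡ _ ⟩
      (x - r zero) * (eval (product ls) x * ds)
        ≈⟨ *-congˡ (step (d ∘ suc) (r ∘ suc) (d≉0 ∘ suc)) ⟩
      (x - r zero) * ∏.sum (λ i → x - r (suc i)) ∎
      where
      i₀ = inv (d zero) (d≉0 zero)
      l₀ = const i₀ ⊠ (X ⊖ const (r zero))
      ls = λ i → const (inv (d (suc i)) (d≉0 (suc i))) ⊠ (X ⊖ const (r (suc i)))
      d₀ = d zero
      ds = ∏.sum (d ∘ suc)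

  -- The numerator contains the factor k = n, which is u_n - u_n.
  F-vanishes : ∀ {m n} → n < m → F⟨ m ⟩ (u n) ≈ 0#
  F-vanishes {m} {n} n<m = *-cancelʳ (D≉0 m) (trans (F*D≈N m (u n)) (trans N≈0 (sym (zeroˡ _))))
    where
    N≈0 : N m (u n) ≈ 0#
    N≈0 = begin
      N m (u n)
        ≡⟨ ≡.cong (λ m → N m (u n)) (≡.trans (ℕ.+-suc n _) (ℕ.m+[n∸m]≡n n<m)) ⟨
      N (n ℕ.+ suc (m ℕ.∸ suc n)) (u n)
        ≈⟨ ∏.range-+ (λ k → u n - u k) n (suc (m ℕ.∸ suc n)) ⟩
      N n (u n) * ((u n - u (n ℕ.+ 0)) * _)
        ≈⟨ y≈0⇒xy≈0 (x≈0⇒xy≈0 (trans (reflexive (≡.cong (λ k → u n - u k) (ℕ.+-identityʳ n))) (-‿inverseʳ (u n)))) ⟩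
      0# ∎

  -- The factors of the `k`-th block whose last digit differs from `d`. Unlike the omitted one, they
  -- are all units of V.
  rest : Fin q → ℕ → ℕ → κ.Carrier
  rest d n k = κ∏.sum λ j → uκ (toℕ d ℕ.+ n ℕ.* q) κ.- uκ (toℕ (punchIn d j) ℕ.+ k ℕ.* q)

  wilson : κ.Carrier
  wilson = κ∏.sum (λ j → repκ (suc j))

  -- Modulo 𝔪 each factor depends only on last digits, and reflection in `d` removes the dependence
  -- on `d`. Hence the contribution of a full block is the same in the numerator, with last digit d,
  -- as in the denominator, with last digit a.
  rest≈wilson : ∀ d n k → rest d n k κ.≈ wilson
  rest≈wilson d n k = κ.trans
    (Sum.sum-cong-≋ κ.*-commutativeMonoid λ j → κ.+-cong (uκ-step d n) (κ.-‿cong (uκ-step (punchIn d j) k)))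
    (∏-differences d)

  -- In the factor with last digit `d` the two terms `rep d` cancel and one π comes out; the other
  -- factors are collected in `rest`.
  block : ∀ d n k → ∏.range (λ i → u (toℕ d ℕ.+ n ℕ.* q) - u (i ℕ.+ k ℕ.* q)) q ≈
                    π * (u n - u k) * proj₁ (rest d n k)
  block d n k = begin
    ∏.sum {q} (λ i → x - y (toℕ i))
      ≈⟨ Sum.sum-remove *-commutativeMonoid {n = suc p} {i = d} (λ i → x - y (toℕ i)) ⟩
    (x - y (toℕ d)) * ∏.sum (λ j → x - y (toℕ (punchIn d j)))
      ≈⟨ *-cong difference (reflexive (proj₁-∏ (λ j → uκ (toℕ d ℕ.+ n ℕ.* q) κ.- uκ (toℕ (punchIn d j) ℕ.+ k ℕ.* q)))) ⟩
    π * (u n - u k) * proj₁ (rest d n k) ∎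
    where
    x = u (toℕ d ℕ.+ n ℕ.* q)
    y : ℕ → Carrier
    y i = u (i ℕ.+ k ℕ.* q)
    difference : x - y (toℕ d) ≈ π * (u n - u k)
    difference = begin
      x - y (toℕ d)                              ≈⟨ +-cong (u-step d n) (-‿cong (u-step d k)) ⟩
      (rep d + π * u n) - (rep d + π * u k)      ≈⟨ +-congˡ (+.⁻¹-∙-comm (rep d) (π * u k)) ⟨
      (rep d + π * u n) + (- rep d - π * u k)    ≈⟨ interchange (rep d) (π * u n) (- rep d) (- (π * u k)) ⟩
      (rep d - rep d) + (π * u n - π * u k)      ≈⟨ +-cong (-‿inverseʳ (rep d)) (sym (K.x[y-z]≈xy-xz π (u n) (u k))) ⟩
      0# + π * (u n - u k)                       ≈⟨ +-identityˡ _ ⟩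
      π * (u n - u k)                            ∎
      where
      open CommutativeSemigroupProperties
        (CommutativeMonoid.commutativeSemigroup +-commutativeMonoid) using (interchange)

  low : Fin q → ℕ → Fin q → ℕ → κ.Carrier
  low d n a m = κ∏.sum {toℕ a} λ i → uκ (toℕ d ℕ.+ n ℕ.* q) κ.- uκ (toℕ i ℕ.+ m ℕ.* q)

  digit-product : Fin q → Fin q → κ.Carrier
  digit-product d a = κ∏.sum {toℕ a} λ i → uκ (toℕ d) κ.- uκ (toℕ i)

  low≈digit-product : ∀ d n a m → low d n a m κ.≈ digit-product d a
  low≈digit-product d n a m = Sum.sum-cong-≋ κ.*-commutativeMonoid {toℕ a} λ i →
    κ.+-cong (κ.trans (uκ-step d n) (κ.sym (uκ-digit d)))
      (κ.-‿cong (≡.subst (λ j → uκ (j ℕ.+ m ℕ.* q) κ.≈ uκ j) (Fin.toℕ-inject≤ i (Fin.toℕ≤n a))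
        (κ.trans (uκ-step (inject≤ i (Fin.toℕ≤n a)) m) (κ.sym (uκ-digit _)))))

  digit-product≉0 : ∀ a → ¬ digit-product a a κ.≈ κ.0#
  digit-product≉0 a = κF.∏-nonzero {toℕ a} _ λ i eq →
    Fin.<⇒≢ (inject≤-< i) (≡.sym (distinct a (inject≤ i _) (congruent (κ-equal i eq))))
    where
    inject≤-< : ∀ (i : Fin (toℕ a)) → toℕ (inject≤ i (Fin.toℕ≤n a)) < toℕ a
    inject≤-< i = ≡.subst (_< toℕ a) (≡.sym (Fin.toℕ-inject≤ i _)) (Fin.toℕ<n i)
    κ-equal : ∀ i → uκ (toℕ a) κ.- uκ (toℕ i) κ.≈ κ.0# → repκ a κ.≈ repκ (inject≤ i (Fin.toℕ≤n a))
    κ-equal i eq = κ.trans (κ.sym (uκ-digit a)) (κ.trans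
      (AbelianGroupProperties.x∙y⁻¹≈ε⇒x≈y κ.+-abelianGroup (uκ (toℕ a)) (uκ (toℕ i)) eq)
      (≡.subst (λ j → uκ j κ.≈ repκ (inject≤ i _)) (Fin.toℕ-inject≤ i (Fin.toℕ≤n a)) (uκ-digit _)))

  -- What remains of the numerator once `π^ m` and `N m (u n)` are split off. The denominator is the
  -- case d = a, n = m, where it is a unit. If a > d it lies in 𝔪, because of the factor i = d of
  -- `low`; this agrees with F_a(u_d) = 0, so no case distinction on the digits is needed.
  unit-part : Fin q → ℕ → Fin q → ℕ → κ.Carrier
  unit-part d n a m = κ∏.range (rest d n) m κ.* low d n a m

  unit-part≈ : ∀ d n a m → unit-part d n a m κ.≈ κ∏.range (λ _ → wilson) m κ.* digit-product d a
  unit-part≈ d n a m = κ.*-cong (κ∏.range-cong (rest≈wilson d n) m) (low≈digit-product d n a m)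

  wilson^≉0 : ∀ m → ¬ κ∏.range (λ _ → wilson) m κ.≈ κ.0#
  wilson^≉0 m = κF.∏-nonzero {m} (λ _ → wilson) (λ _ → ∏-units-nonzero)

  unit-part≉0 : ∀ a m → ¬ unit-part a m a m κ.≈ κ.0#
  unit-part≉0 a m eq = κF.*-nonzero (wilson^≉0 m) (digit-product≉0 a) (κ.trans (κ.sym (unit-part≈ a m a m)) eq)

  π^ : ℕ → Carrier
  π^ = ∏.range (λ _ → π)

  N-step : ∀ d n a m → N (toℕ a ℕ.+ m ℕ.* q) (u (toℕ d ℕ.+ n ℕ.* q)) ≈
                       π^ m * N m (u n) * proj₁ (unit-part d n a m)
  N-step d n a m = begin
    ∏.range f (toℕ a ℕ.+ m ℕ.* q)
      ≡⟨ ≡.cong (∏.range f) (ℕ.+-comm (toℕ a) _) ⟩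
    ∏.range f (m ℕ.* q ℕ.+ toℕ a)
      ≈⟨ ∏.range-+ f (m ℕ.* q) (toℕ a) ⟩
    ∏.range f (m ℕ.* q) * ∏.range (λ i → f (m ℕ.* q ℕ.+ i)) (toℕ a)
      ≈⟨ *-cong (∏.range-* f m q) (∏.range-cong (λ i → reflexive (≡.cong f (ℕ.+-comm (m ℕ.* q) i))) (toℕ a)) ⟩
    ∏.range (λ k → ∏.range (λ i → f (i ℕ.+ k ℕ.* q)) q) m * ∏.range (λ i → f (i ℕ.+ m ℕ.* q)) (toℕ a)
      ≈⟨ *-cong (∏.range-cong (block d n) m) (reflexive (proj₁-∏ {toℕ a} _)) ⟩
    ∏.range (λ k → π * (u n - u k) * proj₁ (rest d n k)) m * proj₁ (low d n a m)
      ≈⟨ *-congʳ (trans (∑-distrib-+ {m} _ _) (*-cong (∑-distrib-+ {m} _ _) (reflexive (proj₁-∏ {m} _)))) ⟩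
    π^ m * N m (u n) * proj₁ (κ∏.range (rest d n) m) * proj₁ (low d n a m)
      ≈⟨ *-assoc _ _ _ ⟩
    π^ m * N m (u n) * proj₁ (unit-part d n a m) ∎
    where
    open Sum *-commutativeMonoid using (∑-distrib-+)
    f : ℕ → Carrier
    f k = u (toℕ d ℕ.+ n ℕ.* q) - u k

  -- The denominator is the numerator evaluated at its own point, so `N-step` expands both, with the
  -- same `π^ m`. The result is an equation in K: the values of `F` are not yet known to lie in V.
  F-step : ∀ d n a m → F⟨ toℕ a ℕ.+ m ℕ.* q ⟩ (u (toℕ d ℕ.+ n ℕ.* q)) * proj₁ (unit-part a m a m) ≈
                       F⟨ m ⟩ (u n) * proj₁ (unit-part d n a m)
  F-step d n a m = *-cancelˡ (*-nonzero (∏-nonzero {m} (λ _ → π) (λ _ → π≉0 Π)) (D≉0 m)) (begin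
    π^ m * D m * (f * U₀)        ≈⟨ solve 4 (λ p d f u → p :* d :* (f :* u) := f :* (p :* d :* u)) refl (π^ m) (D m) f U₀ ⟩
    f * (π^ m * D m * U₀)        ≈⟨ *-congˡ (N-step a m a m) ⟨
    f * D (toℕ a ℕ.+ m ℕ.* q)    ≈⟨ F*D≈N (toℕ a ℕ.+ m ℕ.* q) _ ⟩
    N (toℕ a ℕ.+ m ℕ.* q) _      ≈⟨ N-step d n a m ⟩
    π^ m * N m (u n) * U         ≈⟨ *-congʳ (*-congˡ (F*D≈N m (u n))) ⟨
    π^ m * (f′ * D m) * U        ≈⟨ solve 4 (λ p d f u → p :* (f :* d) :* u := p :* d :* (f :* u)) refl (π^ m) (D m) f′ U ⟩
    π^ m * D m * (f′ * U)        ∎)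
    where
    open SemiringSolver commutativeSemiring using (solve; _:*_; _:=_)
    f = F⟨ toℕ a ℕ.+ m ℕ.* q ⟩ (u (toℕ d ℕ.+ n ℕ.* q))
    f′ = F⟨ m ⟩ (u n)
    U = proj₁ (unit-part d n a m)
    U₀ = proj₁ (unit-part a m a m)

  F-digit : ∀ d a → F⟨ toℕ a ⟩ (u (toℕ d)) * proj₁ (digit-product a a) ≈ proj₁ (digit-product d a)
  F-digit d a = begin
    F⟨ toℕ a ⟩ (u (toℕ d)) * proj₁ (digit-product a a)  ≡⟨ ≡.cong (F⟨ toℕ a ⟩ (u (toℕ d)) *_) (proj₁-∏ {toℕ a} _) ⟨
    F⟨ toℕ a ⟩ (u (toℕ d)) * D (toℕ a)                  ≈⟨ F*D≈N (toℕ a) (u (toℕ d)) ⟩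
    N (toℕ a) (u (toℕ d))                               ≡⟨ proj₁-∏ {toℕ a} _ ⟩
    proj₁ (digit-product d a)                           ∎

  -- Induction on the digits of the argument, with m divided by q alongside: by `F-step` the value
  -- is an earlier one times an element of V, over a unit. At u_0 only F_0 is nonzero.
  F∈V-digits : ∀ (ds : List (Fin q)) m → F⟨ m ⟩ (u (fromDigits ds)) ∈V
  F∈V-digits []       zero    = ∈V-cong {1#} {F⟨ 0 ⟩ (u 0)} (sym (K[x].eval-const 1# (u 0))) 1∈V
  F∈V-digits []       (suc m) = ∈V-cong {0#} {F⟨ suc m ⟩ (u 0)} (sym (F-vanishes {suc m} {0} (s≤s z≤n))) 0∈V
  F∈V-digits (d ∷ ds) m = ≡.subst (λ m → F⟨ m ⟩ (u (fromDigits (d ∷ ds))) ∈V) (≡.sym (DivMod.property m/q))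
    (unit-quotient∈V {F⟨ toℕ a ℕ.+ m′ ℕ.* q ⟩ (u (fromDigits (d ∷ ds)))}
      ((F⟨ m′ ⟩ (u (fromDigits ds)) , F∈V-digits ds m′) κ.* unit-part d (fromDigits ds) a m′)
      (unit-part a m′ a m′) (unit-part≉0 a m′) (F-step d (fromDigits ds) a m′))
    where
    m/q = m divMod q
    m′  = DivMod.quotient m/q
    a   = DivMod.remainder m/q

  F∈V : ∀ m n → F⟨ m ⟩ (u n) ∈V
  F∈V m n = ≡.subst (λ n → F⟨ m ⟩ (u n) ∈V) (proj₂ (toDigits q n)) (F∈V-digits (digits n) m)

  Fκ : ℕ → ℕ → κ.Carrier
  Fκ m n = F⟨ m ⟩ (u n) , F∈V m n

  -- `F-step` modulo 𝔪: the m-th power of `wilson` is common to both unit parts, and the remaining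
  -- quotient of digit products is F_a(u_d) by `F-digit`.
  lucas : ∀ d n a m → Fκ (toℕ a ℕ.+ m ℕ.* q) (toℕ d ℕ.+ n ℕ.* q) κ.≈ Fκ (toℕ a) (toℕ d) κ.* Fκ m n
  lucas d n a m = κF.ratio
    {x = f} {f′} {f₀} {unit-part a m a m} {unit-part d n a m} {w} {digit-product a a} {digit-product d a}
    (κF.*-nonzero (wilson^≉0 m) (digit-product≉0 a))
    (≈⇒≈κ {f κ.* unit-part a m a m} {f′ κ.* unit-part d n a m} (F-step d n a m))
    (unit-part≈ a m a m) (unit-part≈ d n a m) (≈⇒≈κ {f₀ κ.* digit-product a a} {digit-product d a} (F-digit d a))
    where
    f  = Fκ (toℕ a ℕ.+ m ℕ.* q) (toℕ d ℕ.+ n ℕ.* q)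
    f′ = Fκ m n
    f₀ = Fκ (toℕ a) (toℕ d)
    w  = κ∏.range (λ _ → wilson) m

-- Generating polynomials as character sums, and their multiplicativity.

open PolynomialRing ℤ.+-*-commutativeRing using (_≅_; wrap; unwrap; poly-commutativeRing; map-zero; map-⊞; monomial)

module ℤ[x]-Ring = CommutativeRing poly-commutativeRing
module ℤ[x]-∑ = RangeSum ℤ[x]-Ring.+-commutativeMonoid

indicator : ∀ {ℓ} {P : Set ℓ} → Dec P → ℤ
indicator P? = if does P? then 1ℤ else 0ℤ

indicator-yes : ∀ {ℓ} {P : Set ℓ} (P? : Dec P) → P → indicator P? ≡ 1ℤ
indicator-yes (yes _) _ = ≡.refl
indicator-yes (no ¬p) p = contradiction p ¬p

indicator-no : ∀ {ℓ} {P : Set ℓ} (P? : Dec P) → ¬ P → indicator P? ≡ 0ℤ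
indicator-no (yes p) ¬p = contradiction p ¬p
indicator-no (no _)  _  = ≡.refl

-- An exchange of summations: a polynomial whose coefficients count indices is a sum over the
-- indices of polynomials with coefficients 0 and 1.
count-polynomial : ∀ {a ℓ} {S : Set} {A : Set a} {P : S → A → Set ℓ} (P? : ∀ s a → Dec (P s a)) →
                   ∀ {n} (f : Fin n → A) ss →
                   map (λ s → + length (filter (P? s) (tabulate f))) ss ≅
                   ℤ[x]-∑.sum (λ i → map (λ s → indicator (P? s (f i))) ss)
count-polynomial P? {zero}  f ss = map-zero (λ _ → 0ℤ) (λ _ → ≡.refl) ss
count-polynomial P? {suc n} f ss = begin
  map (λ s → + length (filter (P? s) (tabulate f))) ss
    ≡⟨ map-cong split ss ⟩
  map (λ s → indicator (P? s (f zero)) ℤ.+ + length (filter (P? s) (tabulate (f ∘ suc)))) ss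
    ≡⟨ map-⊞ (λ s → indicator (P? s (f zero))) _ ss ⟩
  map (λ s → indicator (P? s (f zero))) ss ℤ[x].⊞ map (λ s → + length (filter (P? s) (tabulate (f ∘ suc)))) ss
    ≈⟨ ℤ[x]-Ring.+-congˡ {map (λ s → indicator (P? s (f zero))) ss} (count-polynomial P? (f ∘ suc) ss) ⟩
  ℤ[x]-∑.sum (λ i → map (λ s → indicator (P? s (f i))) ss) ∎
  where
  open SetoidReasoning ℤ[x]-Ring.setoid
  split : ∀ s → + length (filter (P? s) (tabulate f)) ≡
                indicator (P? s (f zero)) ℤ.+ + length (filter (P? s) (tabulate (f ∘ suc)))
  split s with P? s (f zero)
  ... | yes _ = ≡.refl
  ... | no  _ = ≡.refl

-- The modulus is a variable M because Agda would otherwise unfold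
-- X ^ (q ∸ 1) ⊖ 𝟙 over and over.
module GeneratingPolynomial {c ℓ} (V : DiscreteValuationDomain c ℓ) {p : ℕ} (R : Representatives V (suc (suc p)))
                            (Π : Uniformizer V) (G : PrimitiveElement V) (M : ℤ[x].Poly)
                            (M≅X^[q-1]-1 : M ≅ ℤ[x].X ℤ[x].^ suc p ℤ[x].⊖ ℤ[x].𝟙) where

  open DiscreteValuationDomain V using (_≡_[𝔪]; pow)
  open PrimitiveElement G using (℘; ℘≉0)
  open Construction V R Π G
  open Lucas V R Π G
  open QuotientRing poly-commutativeRing M using (quotientRing; _≈ₘ_; ≈⇒≈ₘ; ≈ₘ-difference; modulus-difference)
  open CommutativeRing quotientRing hiding (zero)
  open RangeSum +-commutativeMonoid using (range; range-*; range-extend)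
  open Exp commutativeSemiring using (_^_; ^-homo-*)
  open SetoidReasoning setoid
  private
    module ∏Q = RangeSum *-commutativeMonoid
    module κF = FieldProperties residueField

  ^-agrees : ∀ x n → x ℤ[x].^ n ≡ x ^ n
  ^-agrees x zero    = ≡.refl
  ^-agrees x (suc n) = ≡.cong (x *_) (^-agrees x n)

  X^[q-1]≈1 : ℤ[x].X ^ suc p ≈ 1#
  X^[q-1]≈1 = trans (reflexive (≡.sym (^-agrees ℤ[x].X (suc p)))) (modulus-difference M≅X^[q-1]-1)

  open Character quotientRing ℤ[x].X X^[q-1]≈1

  ≡℘^⇒≈ : ∀ {z} j → proj₁ z ≡ pow ℘ ℘≉0 (+ j) [𝔪] → z κ.≈ ℘κ κ.^ j
  ≡℘^⇒≈ {z} j z≡ = mod𝔪 (≡.subst (λ y → proj₁ z ≡ y [𝔪]) (≡.sym (proj₁-^ ℘κ j)) z≡)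

  -- The powers ℘ʲ with j < q - 1 are pairwise incongruent, so a nonzero class has exactly one
  -- coefficient 1, at its logarithm, and the class 0 has none.
  indicator-polynomial : ∀ z (z≡℘^? : ∀ j → Dec (proj₁ z ≡ pow ℘ ℘≉0 (+ j) [𝔪])) →
                         map (λ j → indicator (z≡℘^? j)) (upTo (suc p)) ≈ χ z
  indicator-polynomial z z≡℘^? = by-cases (zero-or-power z)
    where
    f : ℕ → ℤ
    f j = indicator (z≡℘^? j)
    zero-case : z κ.≈ κ.0# → map f (upTo (suc p)) ≅ []
    zero-case z≈0 = map-zero f (λ j → indicator-no (z≡℘^? j) λ z≡ →
      κF.^-nonzero ℘κ≉0 j (κ.trans (κ.sym (≡℘^⇒≈ {z} j z≡)) z≈0)) (upTo (suc p))

    power-case : ∀ i → i < suc p → z κ.≈ ℘κ κ.^ i → applyUpTo f (suc p) ≅ ℤ[x].X ℤ[x].^ i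
    power-case i i<q-1 z≈ = monomial f i<q-1
      (indicator-yes (z≡℘^? i) (≡.subst (λ y → proj₁ z ≡ y [𝔪]) (proj₁-^ ℘κ i) (congruent z≈)))
      λ j j<q-1 j≢i → indicator-no (z≡℘^? j) λ z≡ →
        j≢i (^-injective j<q-1 i<q-1 (κ.trans (κ.sym (≡℘^⇒≈ {z} j z≡)) z≈))

    by-cases : z κ.≈ κ.0# ⊎ (∃ λ i → i < suc p × z κ.≈ ℘κ κ.^ i) → map f (upTo (suc p)) ≈ χ z
    by-cases (inj₁ z≈0) = begin
      map f (upTo (suc p))    ≈⟨ ≈⇒≈ₘ (zero-case z≈0) ⟩
      0#                      ≈⟨ χ-zero {z} z≈0 ⟨
      χ z                     ∎
    by-cases (inj₂ (i , i<q-1 , z≈)) = begin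
      map f (upTo (suc p))    ≡⟨ map-upTo f (suc p) ⟩
      applyUpTo f (suc p)     ≈⟨ ≈⇒≈ₘ (power-case i i<q-1 z≈) ⟩
      ℤ[x].X ℤ[x].^ i         ≡⟨ ^-agrees ℤ[x].X i ⟩
      ℤ[x].X ^ i              ≈⟨ χ-power {z} i z≈ ⟨
      χ z                     ∎

  𝒢≈∑ : ∀ n → 𝒢 n ≈ range (λ m → χ (Fκ m n)) (suc n)
  𝒢≈∑ n = trans (≈⇒≈ₘ (count-polynomial (λ j → ε? (+ j) n) id (upTo (suc p))))
    (Sum.sum-cong-≋ +-commutativeMonoid {suc n} λ m →
      indicator-polynomial (Fκ (toℕ m) n) (λ j → ε? (+ j) n m))

  -- Allows the sum over m to fill whole blocks: length (n + 1) q for the index d + n q, and length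
  -- q for the digit d.
  𝒢-extend : ∀ {n k} → n < k → range (λ m → χ (Fκ m n)) k ≈ 𝒢 n
  𝒢-extend {n} {k} n<k = trans
    (range-extend n<k λ m n<m → χ-zero (≈⇒≈κ {Fκ m n} {κ.0#} (F-vanishes {m} {n} n<m)))
    (sym (𝒢≈∑ n))

  𝒢-step : ∀ d n → 𝒢 (toℕ d ℕ.+ n ℕ.* q) ≈ 𝒢 (toℕ d) * 𝒢 n
  𝒢-step d n = begin
    𝒢 n′
      ≈⟨ 𝒢-extend {n′} {suc n ℕ.* q} (ℕ.+-monoˡ-< (n ℕ.* q) (Fin.toℕ<n d)) ⟨
    range (λ m → χ (Fκ m n′)) (suc n ℕ.* q)
      ≈⟨ range-* (λ m → χ (Fκ m n′)) (suc n) q ⟩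
    range (λ m → range (λ a → χ (Fκ (a ℕ.+ m ℕ.* q) n′)) q) (suc n)
      ≈⟨ sum-cong-≋ {suc n} (λ m → sum-cong-≋ {q} λ a →
           trans (χ-cong (lucas d n a (toℕ m))) (χ-* (Fκ (toℕ a) (toℕ d)) (Fκ (toℕ m) n))) ⟩
    range (λ m → range (λ a → χ (Fκ a (toℕ d)) * χ (Fκ m n)) q) (suc n)
      ≈⟨ sum-cong-≋ {suc n} (λ m → *-distribʳ-sum {q} (χ (Fκ (toℕ m) n)) (λ a → χ (Fκ (toℕ a) (toℕ d)))) ⟨
    range (λ m → range (λ a → χ (Fκ a (toℕ d))) q * χ (Fκ m n)) (suc n)
      ≈⟨ *-distribˡ-sum {suc n} (range (λ a → χ (Fκ a (toℕ d))) q) (λ m → χ (Fκ (toℕ m) n)) ⟨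
    range (λ a → χ (Fκ a (toℕ d))) q * range (λ m → χ (Fκ m n)) (suc n)
      ≈⟨ *-cong (𝒢-extend (Fin.toℕ<n d)) (sym (𝒢≈∑ n)) ⟩
    𝒢 (toℕ d) * 𝒢 n ∎
    where
    open SemiringSum semiring using (sum-cong-≋; *-distribˡ-sum; *-distribʳ-sum)
    n′ = toℕ d ℕ.+ n ℕ.* q

  𝒢-zero : 𝒢 0 ≈ 1#
  𝒢-zero = trans (𝒢≈∑ 0) (trans (+-identityʳ _)
    (χ-power {Fκ 0 0} 0 (≈⇒≈κ {Fκ 0 0} {κ.1#} (K[x].eval-const _ (u 0)))))

  𝒢-digits : ∀ (ds : List (Fin q)) →
             𝒢 (fromDigits ds) ≈ ∏Q.sum {q} (λ j → 𝒢 (toℕ j) ^ length (filter (j Fin.≟_) ds))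
  𝒢-digits []       = trans 𝒢-zero (sym (∏Q.range-ε (λ _ → refl {1#}) q))
  𝒢-digits (d ∷ ds) = begin
    𝒢 (toℕ d ℕ.+ fromDigits ds ℕ.* q)
      ≈⟨ 𝒢-step d (fromDigits ds) ⟩
    𝒢 (toℕ d) * 𝒢 (fromDigits ds)
      ≈⟨ *-congˡ {𝒢 (toℕ d)} (𝒢-digits ds) ⟩
    𝒢 (toℕ d) * ∏Q.sum {q} (λ j → 𝒢 (toℕ j) ^ length (filter (j Fin.≟_) ds))
      ≈⟨ ∏Q.sum-multiplicity (𝒢 ∘ toℕ) d ds ⟨
    ∏Q.sum {q} (λ j → 𝒢 (toℕ j) ^ length (filter (j Fin.≟_) (d ∷ ds))) ∎

  𝒢≈∏ : ∀ n → 𝒢 n ≈ ℤ[x].product (λ (j : Fin q) → 𝒢 (toℕ j) ℤ[x].^ e j n)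
  𝒢≈∏ n = begin
    𝒢 n
      ≡⟨ ≡.cong 𝒢 (proj₂ (toDigits q n)) ⟨
    𝒢 (fromDigits (digits n))
      ≈⟨ 𝒢-digits (digits n) ⟩
    ∏Q.sum {q} (λ j → 𝒢 (toℕ j) ^ e j n)
      ≡⟨ Sum.sum-cong-≗ *-commutativeMonoid {q} (λ j → ^-agrees (𝒢 (toℕ j)) (e j n)) ⟨
    ℤ[x].product {q} (λ j → 𝒢 (toℕ j) ℤ[x].^ e j n) ∎

  𝒢≡∏ : ∀ n → 𝒢 n ℤ[x].≡ ℤ[x].product (λ (j : Fin q) → 𝒢 (toℕ j) ℤ[x].^ e j n) [mod M ]
  𝒢≡∏ n = _≈ₘ_.quotient (𝒢≈∏ n) Divisibility., unwrap (≈ₘ-difference (𝒢≈∏ n))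

theorem3p6 : ∀ {c ℓ} (V : DiscreteValuationDomain c ℓ) {q : ℕ} (R : Representatives V q)
    (Π : Uniformizer V) (G : PrimitiveElement V) (n : ℕ) →
    let open Construction V R Π G
        open ℤ[x]
    in 𝒢 n ≡ product (λ (j : Fin q) → 𝒢 (toℕ j) ^ e j n) [mod X ^ (q ∸ 1) ⊖ 𝟙 ]
-- As 0 and 1 are incongruent modulo 𝔪, q is at least 2. Splitting q lets `q ∸ 1` reduce to `suc p`.
theorem3p6 V {zero}        R Π G n = contradiction (RepresentativesProperties.q≥2 V R) λ ()
theorem3p6 V {suc zero}    R Π G n = contradiction (RepresentativesProperties.q≥2 V R) λ { (s≤s ()) }
theorem3p6 V {suc (suc p)} R Π G n =
  GeneratingPolynomial.𝒢≡∏ V R Π G (ℤ[x].X ℤ[x].^ suc p ℤ[x].⊖ ℤ[x].𝟙) ℤ[x]-Ring.refl n
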